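{- Let $q\in(0,1)$ and let $1\le n\le m$ be integers. The unique stationary distribution $\pi_{m,n,q}$ of the bounded geometric juggler's exclusion process with $n$ particles, $m$ admissible heights and parameter $q$ is given by $$\pi_{m,n,q}(B)=Z^{ -1}\prod_{x\in B}\Bigl([\,1+v_B(x)\,]_q\;q^x\Bigr)\qquad\text{for every } B\subset\{0,\ldots,m-1\}\text{ with }|B|=n,$$ where $v_B(x)=\bigl|\{x,\ldots,m-1\}\setminus B\bigr|$ and $$Z=Z(m,n,q)=q^{ -n+\binom{m+1}{2}}\,S_{1/q}[m+1,m-n+1].$$
   Context: For $r>0$, $r\ne1$ and an integer $k\ge0$, $[k]_r=(1-r^k)/(1-r)$. The $q$-Stirling numbers of the second kind $S_r[a,b]$ are defined by $S_r[0,0]=1$, $S_r[a,b]=0$ for $b<0$ or $b>a$, and $S_r[a+1,b]=r^{b-1}S_r[a,b-1]+[b]_rS_r[a,b]$ for $0\le b\le a+1$; $S_{1/q}$ means $r=1/q$. $\mathbb{Z}_+=\{0,1,2,\ldots\}$. For a finite set $A\subset\mathbb{Z}_+$, $\theta_A$ denotes the order-preserving bijection from $\mathbb{Z}_+$ onto $\mathbb{Z}_+\setminus A$. For a set $X$ of integers, $X-1=\{x-1:x\in X\}$. The bounded geometric juggler's exclusion process (JEP) with $n$ particles, $m\ge n$ admissible heights and parameter $q\in(0,1)$ is the Markov chain $(X_t)_{t\ge0}$ on the $n$-element subsets of $\{0,\ldots,m-1\}$ with the following dynamics. If $0\notin X_t$, then $X_{t+1}=X_t-1$. If $0\in X_t$,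 put $X_t^*=(X_t\setminus\{0\})-1$; then $X_{t+1}=X_t^*\cup\{\theta_{X_t^*}(\xi_t)\}$, where the $\xi_t$ are independent random integers (independent of $X_0$) with the truncated geometric distribution $\mathrm{P}(\xi_t=x)=\frac{1-q}{1-q^{\ell}}q^x$ for $x\in\{0,\ldots,\ell-1\}$, with $\ell=m-n+1$. This chain is known to be ergodic, with a unique stationary distribution, denoted $\pi_{m,n,q}$. -}

module Defs where

open import Algebra.Bundles using (CommutativeRing)
open import Data.Bool.Base using (if_then_else_)
open import Data.Bool.Properties using () renaming (_≟_ to _≟ᵇ_)
open import Data.Fin.Base using (Fin; zero; suc; toℕ)
open import Data.Fin.Properties using (toℕ<n)
open import Data.Fin.Subset using (Subset; inside; outside; ∣_∣; _∈_; _∪_; _─_; ⊥; ∁)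
open import Data.Fin.Subset.Properties using (_∈?_; ∣p∣≤n; ∣∁p∣≡n∸∣p∣; ∪-identityʳ)
open import Data.List.Base using (List; []; _∷_; _++_; map; foldr; filter; allFin)
open import Data.Nat.Base as ℕ using (ℕ; zero; suc; _∸_; s≤s; z≤n)
open import Data.Nat.Combinatorics using () renaming (_C_ to _choose_)
open import Data.Nat.Properties as ℕₚ using (_≟_; _≤?_)
open import Data.Product.Base using (Σ; ∃; _×_; _,_; proj₁)
open import Data.Vec.Base using ([]; _∷_; _∷ʳ_; tabulate; here; there)
open import Data.Vec.Properties using (≡-dec)
open import Level using (Level; _⊔_) renaming (suc to lsuc)
open import Relation.Binary.Core using (Rel)
open import Relation.Binary.PropositionalEquality
  using (_≡_; refl; sym; trans; cong; subst; module ≡-Reasoning)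
open import Relation.Binary.Structures using (IsStrictTotalOrder)
open import Relation.Nullary.Decidable.Core using (does)
open import Relation.Nullary.Negation.Core using (¬_)

------------------------------------------------------------------------
-- Ordered fields

-- The classical axioms, with trichotomy.  Inversion is made total by the
-- convention 0⁻¹ = 0.  The real numbers of classical mathematics are an
-- instance; neither completeness nor the Archimedean property is assumed.

record OrderedField (c ℓ₁ ℓ₂ : Level) : Set (lsuc (c ⊔ ℓ₁ ⊔ ℓ₂)) where
  infix  4 _<_
  infix  8 _⁻¹
  infixl 7 _/_
  field
    commutativeRing : CommutativeRing c ℓ₁

  open CommutativeRing commutativeRing public

  field
    _<_                : Rel Carrier ℓ₂
    isStrictTotalOrder : IsStrictTotalOrder _≈_ _<_
    0<1                : 0# < 1#
    +-monoʳ-<          : ∀ x {y z} → y < z → x + y < x + z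
    *-pos              : ∀ {x y} → 0# < x → 0# < y → 0# < x * y
    _⁻¹                : Carrier → Carrier
    ⁻¹-cong            : ∀ {x y} → x ≈ y → x ⁻¹ ≈ y ⁻¹
    ⁻¹-inverseʳ        : ∀ {x} → ¬ x ≈ 0# → x * x ⁻¹ ≈ 1#
    0⁻¹≈0              : 0# ⁻¹ ≈ 0#

  open import Relation.Binary.Construct.StrictToNonStrict _≈_ _<_ public
    using (_≤_)
  open import Algebra.Properties.Semiring.Exp semiring public
    using (_^_)

  _/_ : Carrier → Carrier → Carrier
  x / y = x * y ⁻¹

  ∑ : ∀ {a} {A : Set a} → List A → (A → Carrier) → Carrier
  ∑ xs f = foldr _+_ 0# (map f xs)

  ∏ : ∀ {a} {A : Set a} → List A → (A → Carrier) → Carrier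
  ∏ xs f = foldr _*_ 1# (map f xs)

------------------------------------------------------------------------
-- Finite subsets of ℕ: a Subset m is a subset of {0,…,m−1}

infix 4 _∈ₙ_

_∈ₙ_ : ∀ {m} → ℕ → Subset m → Set
k ∈ₙ A = ∃ λ i → toℕ i ≡ k × i ∈ A

θ : ∀ {m} → Subset m → ℕ → ℕ
θ []            k       = k
θ (inside  ∷ A) k       = suc (θ A k)
θ (outside ∷ A) zero    = zero
θ (outside ∷ A) (suc k) = suc (θ A k)

-- The next three lemmas characterise θ A as the order-preserving
-- bijection from ℕ onto ℕ ∖ A.

θ-mono-< : ∀ {m} (A : Subset m) {j k} → j ℕ.< k → θ A j ℕ.< θ A k
θ-mono-< []            j<k                   = j<k
θ-mono-< (inside  ∷ A) j<k                   = s≤s (θ-mono-< A j<k)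
θ-mono-< (outside ∷ A) {zero}  {suc k} _     = s≤s z≤n
θ-mono-< (outside ∷ A) {suc j} {suc k} (s≤s j<k) = s≤s (θ-mono-< A j<k)

θ-∉ : ∀ {m} (A : Subset m) k → ¬ θ A k ∈ₙ A
θ-∉ (inside  ∷ A) k       (suc i , eq , there i∈A) = θ-∉ A k (i , ℕₚ.suc-injective eq , i∈A)
θ-∉ (outside ∷ A) (suc k) (suc i , eq , there i∈A) = θ-∉ A k (i , ℕₚ.suc-injective eq , i∈A)
θ-∉ (outside ∷ A) zero    (suc i , () , _)

θ-onto : ∀ {m} (A : Subset m) j → ¬ j ∈ₙ A → ∃ λ k → θ A k ≡ j
θ-onto []            j       _   = j , refl
θ-onto (inside  ∷ A) zero    j∉A with () ← j∉A (zero , refl , here)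
θ-onto (inside  ∷ A) (suc j) j∉A
  with k , eq ← θ-onto A j (λ (i , e , i∈A) → j∉A (suc i , cong suc e , there i∈A))
  = k , cong suc eq
θ-onto (outside ∷ A) zero    _   = zero , refl
θ-onto (outside ∷ A) (suc j) j∉A
  with k , eq ← θ-onto A j (λ (i , e , i∈A) → j∉A (suc i , cong suc e , there i∈A))
  = suc k , cong suc eq

-- {k} ∩ {0,…,m−1}
singleton : ∀ {m} → ℕ → Subset m
singleton k = tabulate λ i → does (toℕ i ≟ k)

-- {k,…,m−1}
from : ∀ {m} → ℕ → Subset m
from k = tabulate λ i → does (k ≤? toℕ i)

elements : ∀ {m} → Subset m → List (Fin m)
elements A = filter (_∈? A) (allFin _)

------------------------------------------------------------------------
-- The juggler's exclusion process

State : ℕ → ℕ → Set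
State m n = Σ (Subset m) λ X → ∣ X ∣ ≡ n

-- Dropping the entry for 0 and appending an empty site at height m−1 turns
-- the vector of X into that of (X ∖ {0}) − 1.
step : ∀ {m} → Subset m → ℕ → Subset m
step []            ξ = []
step (outside ∷ X) ξ = X ∷ʳ outside
step (inside  ∷ X) ξ = X* ∪ singleton (θ X* ξ)
  where X* = X ∷ʳ outside

∣∷ʳ-outside∣ : ∀ {m} (X : Subset m) → ∣ X ∷ʳ outside ∣ ≡ ∣ X ∣
∣∷ʳ-outside∣ []            = refl
∣∷ʳ-outside∣ (inside  ∷ X) = cong suc (∣∷ʳ-outside∣ X)
∣∷ʳ-outside∣ (outside ∷ X) = ∣∷ʳ-outside∣ X

∣∪-singleton-θ∣ : ∀ {m} (A : Subset m) k → k ℕ.< ∣ ∁ A ∣ →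
                  ∣ A ∪ singleton (θ A k) ∣ ≡ suc ∣ A ∣
∣∪-singleton-θ∣ (inside  ∷ A) k       k<      = cong suc (∣∪-singleton-θ∣ A k k<)
∣∪-singleton-θ∣ (outside ∷ A) (suc k) (s≤s k<) = ∣∪-singleton-θ∣ A k k<
∣∪-singleton-θ∣ (outside ∷ A) zero    _       =
  cong (λ B → suc ∣ B ∣) (trans (cong (A ∪_) empty) (∪-identityʳ A))
  where
  empty : ∀ {m} → tabulate {n = m} (λ i → does (suc (toℕ i) ≟ 0)) ≡ ⊥
  empty {zero}  = refl
  empty {suc m} = cong (outside ∷_) (empty {m})

∣step∣ : ∀ {m} (X : Subset m) ξ → ξ ℕ.< suc (m ∸ ∣ X ∣) → ∣ step X ξ ∣ ≡ ∣ X ∣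
∣step∣ []            ξ _  = refl
∣step∣ (outside ∷ X) ξ _  = ∣∷ʳ-outside∣ X
∣step∣ {suc m} (inside ∷ X) ξ ξ< =
  trans (∣∪-singleton-θ∣ X* ξ (subst (ξ ℕ.<_) (sym holes) ξ<)) (cong suc (∣∷ʳ-outside∣ X))
  where
  X* = X ∷ʳ outside
  open ≡-Reasoning
  holes : ∣ ∁ X* ∣ ≡ suc (m ∸ ∣ X ∣)
  holes = begin
    ∣ ∁ X* ∣           ≡⟨ ∣∁p∣≡n∸∣p∣ X* ⟩
    suc m ∸ ∣ X* ∣     ≡⟨ cong (suc m ∸_) (∣∷ʳ-outside∣ X) ⟩
    suc m ∸ ∣ X ∣      ≡⟨ ℕₚ.+-∸-assoc 1 (∣p∣≤n X) ⟩
    suc (m ∸ ∣ X ∣)    ∎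

-- The random mapping X_{t+1} = update X_t ξ_t, with ξ_t ∈ {0,…,ℓ−1} and
-- ℓ = m − n + 1.
update : ∀ {m n} → State m n → Fin (suc (m ∸ n)) → State m n
update (X , refl) ξ = step X (toℕ ξ) , ∣step∣ X (toℕ ξ) (toℕ<n ξ)

states : ∀ m n → List (State m n)
states zero    zero    = ([] , refl) ∷ []
states zero    (suc n) = []
states (suc m) zero    = map (λ (X , p) → outside ∷ X , p) (states m zero)
states (suc m) (suc n) = map (λ (X , p) → inside  ∷ X , cong suc p) (states m n)
                      ++ map (λ (X , p) → outside ∷ X , p) (states m (suc n))

holesFrom : ∀ {m} → Subset m → Fin m → ℕ
holesFrom B x = ∣ from (toℕ x) ─ B ∣

module JEP {c ℓ₁ ℓ₂} (K : OrderedField c ℓ₁ ℓ₂) where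

  open OrderedField K hiding (zero)

  [_]⟨_⟩ : ℕ → Carrier → Carrier
  [ k ]⟨ r ⟩ = (1# - r ^ k) / (1# - r)

  -- In the second-index-zero case the term r⁻¹ S_r[a,−1] vanishes.  The
  -- recursion also yields S_r[a,b] = 0 for b > a.
  S : Carrier → ℕ → ℕ → Carrier
  S r zero    zero    = 1#
  S r zero    (suc b) = 0#
  S r (suc a) zero    = [ 0 ]⟨ r ⟩ * S r a zero
  S r (suc a) (suc b) = r ^ b * S r a b + [ suc b ]⟨ r ⟩ * S r a (suc b)

  truncGeom : Carrier → (ℓ : ℕ) → Fin ℓ → Carrier
  truncGeom q ℓ x = (1# - q) / (1# - q ^ ℓ) * q ^ toℕ x

  transition : ∀ q m n → State m n → State m n → Carrier
  transition q m n X Y = ∑ (allFin (suc (m ∸ n))) λ ξ →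
    if does (≡-dec _≟ᵇ_ (proj₁ (update X ξ)) (proj₁ Y))
    then truncGeom q (suc (m ∸ n)) ξ
    else 0#

  record IsStationary (q : Carrier) (m n : ℕ) (π : State m n → Carrier) : Set (c ⊔ ℓ₁ ⊔ ℓ₂) where
    field
      nonNegative : ∀ X → 0# ≤ π X
      total       : ∑ (states m n) π ≈ 1#
      invariant   : ∀ Y → ∑ (states m n) (λ X → π X * transition q m n X Y) ≈ π Y

  -- For 1 ≤ n ≤ m the exponent is exact, since n ≤ m ≤ m (m + 1) / 2.
  Z : ℕ → ℕ → Carrier → Carrier
  Z m n q = q ^ ((suc m choose 2) ∸ n) * S (q ⁻¹) (suc m) (suc (m ∸ n))

  π-formula : ∀ q m n → State m n → Carrier
  π-formula q m n (B , _) =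
    Z m n q ⁻¹ * ∏ (elements B) λ x → [ 1 ℕ.+ holesFrom B x ]⟨ q ⟩ * q ^ toℕ x

{-# OPTIONS --safe #-}
module Submission where

-- Let W(B) = ∏_{x ∈ B} [1 + v_B(x)] q^x.  Reading B from the lowest height, W
-- satisfies a recursion on the indicator vector of B.  Splitting the
-- predecessors of Y in the same way, the equilibrium equation for W follows by
-- induction on Y, and ∑_B W(B) satisfies the recursion of the q-Stirling
-- numbers, since q^k [k + 1]_{1/q} = [k + 1]_q.  For uniqueness, let d be the
-- difference of two stationary distributions, with d(G) ≤ 0 at the state
-- G = {0,…,n−1} (else exchange them).  Its positive part is subinvariant, hence
-- invariant because total mass is preserved, and it vanishes at G.  So it
-- vanishes wherever G can be reached, and throwing ξ = 0 repeatedly leads every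
-- state to G.  Thus d ≤ 0, and d = 0 because its total is 0.

open import Defs
open import Data.Bool.Base using (true; false; if_then_else_)
open import Data.Bool.Properties using () renaming (_≟_ to _≟ᵇ_)
open import Data.Empty using (⊥-elim)
open import Data.Fin.Base using (Fin; zero; suc; toℕ)
open import Data.Fin.Subset using (Subset; inside; outside; ∣_∣; _∪_; _─_; ⊥; ∁)
open import Data.Fin.Subset.Properties using (_∈?_; ∣p∣≤n; ∣∁p∣≡n∸∣p∣; ∪-identityʳ)
open import Data.List.Base as List using (List; []; _∷_; _++_; map; filter; length; allFin)
open import Data.List.Membership.Propositional using (_∈_)
open import Data.List.Membership.Propositional.Properties using (∈-map⁺; ∈-++⁺ˡ; ∈-++⁺ʳ; ∈-allFin)
open import Data.List.Properties using (map-tabulate; length-map)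
open import Data.List.Relation.Unary.Any using (here; there)
open import Data.Nat.Base as ℕ using (ℕ; zero; suc; _∸_; z≤n; s≤s)
open import Data.Nat.Combinatorics using (nC1≡n; nCk+nC[k+1]≡[n+1]C[k+1]) renaming (_C_ to _choose_)
open import Data.Nat.Induction using (<-wellFounded)
import Data.Nat.Properties as ℕₚ
open import Data.Product.Base using (_×_; _,_; proj₁; proj₂)
open import Data.Sum.Base using (_⊎_; inj₁; inj₂)
open import Data.Vec.Base using ([]; _∷_; _∷ʳ_; tabulate)
open import Data.Vec.Properties using (≡-dec; tabulate-cong)
open import Function.Base using (id; _∘_)
open import Induction.WellFounded using (Acc; acc)
open import Level using (_⊔_)
open import Relation.Binary.Definitions using (tri<; tri≈; tri>)
open import Relation.Binary.PropositionalEquality as ≡ using (_≡_; cong; subst)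
open import Relation.Binary.Structures using (IsStrictTotalOrder)
open import Relation.Nullary.Decidable.Core using (does)
open import Relation.Nullary.Negation.Core using (¬_)

pattern ≡refl = ≡.refl

-- Subsets as indicator vectors: sizes, states and element lists.

∣∁∷ʳ-outside∣ : ∀ {m} (X : Subset m) → ∣ ∁ (X ∷ʳ outside) ∣ ≡ suc ∣ ∁ X ∣
∣∁∷ʳ-outside∣ []            = ≡refl
∣∁∷ʳ-outside∣ (inside  ∷ X) = ∣∁∷ʳ-outside∣ X
∣∁∷ʳ-outside∣ (outside ∷ X) = cong suc (∣∁∷ʳ-outside∣ X)

∣∁∣-State : ∀ {m n} ((X , _) : State m n) → ∣ ∁ X ∣ ≡ m ∸ n
∣∁∣-State (X , ≡refl) = ∣∁p∣≡n∸∣p∣ X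

n≤m-State : ∀ {m n} → State m n → n ℕ.≤ m
n≤m-State (X , ≡refl) = ∣p∣≤n X

State-≡ : ∀ {m n} {s t : State m n} → proj₁ s ≡ proj₁ t → s ≡ t
State-≡ {s = X , p} {t = .X , q} ≡refl = cong (X ,_) (ℕₚ.≡-irrelevant p q)

∷-inside : ∀ {m n} → State m n → State (suc m) (suc n)
∷-inside (X , p) = inside ∷ X , cong suc p

∷-outside : ∀ {m n} → State m n → State (suc m) n
∷-outside (X , p) = outside ∷ X , p

∈-states : ∀ {m n} (s : State m n) → s ∈ states m n
∈-states ([] , ≡refl) = here ≡refl
∈-states (inside ∷ X , ≡refl) = ∈-++⁺ˡ (∈-map⁺ _ (∈-states (X , ≡refl)))
∈-states {n = zero}  (outside ∷ X , p) = ∈-map⁺ _ (∈-states (X , p))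
∈-states {n = suc n} (outside ∷ X , p) = ∈-++⁺ʳ _ (∈-map⁺ _ (∈-states (X , p)))

update-step : ∀ {m n} (s : State m n) ξ → proj₁ (update s ξ) ≡ step (proj₁ s) (toℕ ξ)
update-step (X , ≡refl) ξ = ≡refl

filter-map-suc : ∀ {m b} (B : Subset m) (xs : List (Fin m)) →
                 filter (_∈? (b ∷ B)) (map suc xs) ≡ map suc (filter (_∈? B) xs)
filter-map-suc B [] = ≡refl
filter-map-suc B (x ∷ xs) with does (x ∈? B)
... | true  = cong (suc x ∷_) (filter-map-suc B xs)
... | false = filter-map-suc B xs

-- `allFin (suc m)` unfolds to `zero ∷ tabulate suc`, so this is what remains of `elements (b ∷ B)`
-- once height 0 has been dealt with.
filter-tabulate-suc : ∀ {m b} (B : Subset m) →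
  filter (_∈? (b ∷ B)) (List.tabulate suc) ≡ map suc (elements B)
filter-tabulate-suc B = ≡.trans (cong (filter (_∈? (_ ∷ B))) (≡.sym (map-tabulate id suc)))
                                (filter-map-suc B (allFin _))

length-elements : ∀ {m} (B : Subset m) → length (elements B) ≡ ∣ B ∣
length-elements [] = ≡refl
length-elements (inside ∷ B) = cong suc (≡.trans (cong length (filter-tabulate-suc B))
  (≡.trans (length-map suc (elements B)) (length-elements B)))
length-elements (outside ∷ B) = ≡.trans (cong length (filter-tabulate-suc B))
  (≡.trans (length-map suc (elements B)) (length-elements B))

-- Height 0 lies below every shifted height, so the status of that site is never counted.
holesFrom-suc : ∀ {m} b (B : Subset m) x → holesFrom (b ∷ B) (suc x) ≡ holesFrom B x
holesFrom-suc b B x = ≡.trans (drop b) (cong (λ A → ∣ A ─ B ∣) (tabulate-cong (shift (toℕ x) ∘ toℕ)))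
  where
  shift : ∀ k j → does (suc k ℕₚ.≤? suc j) ≡ does (k ℕₚ.≤? j)
  shift zero    j = ≡refl
  shift (suc k) j = ≡refl

  drop : ∀ b → holesFrom (b ∷ B) (suc x) ≡
         ∣ tabulate (λ i → does (suc (toℕ x) ℕₚ.≤? suc (toℕ i))) ─ B ∣
  drop inside  = ≡refl
  drop outside = ≡refl

holesFrom-zero : ∀ {m} (B : Subset m) → holesFrom (inside ∷ B) zero ≡ ∣ ∁ B ∣
holesFrom-zero = full
  where
  full : ∀ {m} (B : Subset m) → ∣ tabulate (λ _ → true) ─ B ∣ ≡ ∣ ∁ B ∣
  full [] = ≡refl
  full (inside  ∷ B) = full B
  full (outside ∷ B) = cong suc (full B)

-- Throws ξ = 0: inversions and reachability of the ground state.

step-outside-zero : ∀ {m} (X : Subset m) → step (inside ∷ outside ∷ X) 0 ≡ inside ∷ (X ∷ʳ outside)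
step-outside-zero X = cong (inside ∷_)
  (≡.trans (cong ((X ∷ʳ outside) ∪_) empty) (∪-identityʳ (X ∷ʳ outside)))
  where
  empty : ∀ {m} → tabulate {n = m} (λ i → does (suc (toℕ i) ℕₚ.≟ 0)) ≡ ⊥
  empty {zero}  = ≡refl
  empty {suc m} = cong (outside ∷_) (empty {m})

-- The throw ξ = 0 moves the lowest hole of X to the top.
step-inside-zero : ∀ {m} (X : Subset m) → step (inside ∷ X) 0 ≡ inside ∷ step X 0
step-inside-zero []            = ≡refl
step-inside-zero (inside  ∷ X) = ≡refl
step-inside-zero (outside ∷ X) = step-outside-zero X

-- The number of pairs (hole, particle) with the hole below the particle.
inversions : ∀ {m} → Subset m → ℕ
inversions []            = 0
inversions (inside  ∷ X) = inversions X
inversions (outside ∷ X) = ∣ X ∣ ℕ.+ inversions X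

inversions-∷ʳ : ∀ {m} (X : Subset m) → inversions (X ∷ʳ outside) ≡ inversions X
inversions-∷ʳ []            = ≡refl
inversions-∷ʳ (inside  ∷ X) = inversions-∷ʳ X
inversions-∷ʳ (outside ∷ X) = ≡.cong₂ ℕ._+_ (∣∷ʳ-outside∣ X) (inversions-∷ʳ X)

∣∣≡0⇒inversions≡0 : ∀ {m} (X : Subset m) → ∣ X ∣ ≡ 0 → inversions X ≡ 0
∣∣≡0⇒inversions≡0 []            _ = ≡refl
∣∣≡0⇒inversions≡0 (outside ∷ X) p = ≡.cong₂ ℕ._+_ p (∣∣≡0⇒inversions≡0 X p)

-- Particles below the lowest hole stay in place. Moving that hole to the top removes its
-- inversions, one for each particle above it. If there is none, no inversions exist at all.
inversions-step : ∀ {m} (X : Subset m) → inversions X ≡ 0 ⊎ inversions (step X 0) ℕ.< inversions X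
inversions-step [] = inj₁ ≡refl
inversions-step (inside ∷ X) rewrite step-inside-zero X = inversions-step X
inversions-step (outside ∷ X) with ∣ X ∣ in eq
... | zero  = inj₁ (∣∣≡0⇒inversions≡0 X eq)
... | suc k = inj₂ (s≤s (subst (ℕ._≤ k ℕ.+ inversions X) (≡.sym (inversions-∷ʳ X))
                                (ℕₚ.m≤n+m _ k)))

-- Without inversions no particle lies above a hole, so the particles fill the lowest sites and
-- their number determines the set. In the mixed cases, a hole at the bottom forces one set to be
-- empty while the other is not.
inversions≡0⇒≡ : ∀ {m} (X Y : Subset m) → ∣ X ∣ ≡ ∣ Y ∣ →
                 inversions X ≡ 0 → inversions Y ≡ 0 → X ≡ Y
inversions≡0⇒≡ [] [] _ _ _ = ≡refl
inversions≡0⇒≡ (inside ∷ X) (inside ∷ Y) e p r =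
  cong (inside ∷_) (inversions≡0⇒≡ X Y (ℕₚ.suc-injective e) p r)
inversions≡0⇒≡ (outside ∷ X) (outside ∷ Y) e p r =
  cong (outside ∷_) (inversions≡0⇒≡ X Y e (ℕₚ.m+n≡0⇒n≡0 ∣ X ∣ p) (ℕₚ.m+n≡0⇒n≡0 ∣ Y ∣ r))
inversions≡0⇒≡ (inside ∷ X) (outside ∷ Y) e p r
  with () ← ≡.trans e (ℕₚ.m+n≡0⇒m≡0 ∣ Y ∣ r)
inversions≡0⇒≡ (outside ∷ X) (inside ∷ Y) e p r
  with () ← ≡.trans (≡.sym e) (ℕₚ.m+n≡0⇒m≡0 ∣ X ∣ p)

ground : ∀ {m n} → n ℕ.≤ m → State m n
ground {zero}  {zero}  _         = [] , ≡refl
ground {suc m} {zero}  _         = ∷-outside (ground z≤n)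
ground {suc m} {suc n} (s≤s n≤m) = ∷-inside (ground n≤m)

inversions-ground : ∀ {m n} (n≤m : n ℕ.≤ m) → inversions (proj₁ (ground n≤m)) ≡ 0
inversions-ground {zero}  {zero}  _         = ≡refl
inversions-ground {suc m} {zero}  _         =
  ≡.cong₂ ℕ._+_ (proj₂ (ground {m} z≤n)) (inversions-ground {m} z≤n)
inversions-ground {suc m} {suc n} (s≤s n≤m) = inversions-ground n≤m

-- Reachability of the ground state in the form of an induction principle. Each throw ξ = 0 lowers
-- the number of inversions until it is 0, and then the state is `ground n≤m`.
ground-induction : ∀ {m n p} (n≤m : n ℕ.≤ m) (P : State m n → Set p) → P (ground n≤m) →
                   (∀ s → P (update s zero) → P s) → ∀ s → P s
ground-induction n≤m P base back s = go s (<-wellFounded _)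
  where
  go : ∀ s → Acc ℕ._<_ (inversions (proj₁ s)) → P s
  go s (acc rs) with inversions-step (proj₁ s)
  ... | inj₁ e = subst P (State-≡ (inversions≡0⇒≡ _ _
                   (≡.trans (proj₂ (ground n≤m)) (≡.sym (proj₂ s))) (inversions-ground n≤m) e)) base
  ... | inj₂ lt = back s (go (update s zero)
                   (rs (subst (λ X → inversions X ℕ.< _) (≡.sym (update-step s zero)) lt)))

-- Triangular numbers in the exponent of `Z`.

triangle-suc : ∀ m → suc (suc m) choose 2 ≡ suc m ℕ.+ suc m choose 2
triangle-suc m = ≡.trans (≡.sym (nCk+nC[k+1]≡[n+1]C[k+1] (suc m) 1))
                         (cong (ℕ._+ (suc m choose 2)) (nC1≡n (suc m)))

-- Makes the truncated subtraction in the exponent of `Z` exact for `n ≤ m`.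
m≤triangle : ∀ m → m ℕ.≤ suc m choose 2
m≤triangle zero    = z≤n
m≤triangle (suc m) = subst (suc m ℕ.≤_) (≡.sym (triangle-suc m)) (ℕₚ.m≤m+n _ _)

-- Splits off the power `q ^ (m ∸ n)` that converts `[ suc (m ∸ n) ]` at base 1/q into the same
-- number at base q.
triangle-split : ∀ {m n e} → n ℕ.≤ m → e ℕ.+ suc n ≡ suc (suc m) choose 2 →
                 e ≡ (m ∸ n) ℕ.+ suc m choose 2
triangle-split {m} {n} {e} n≤m eq = ℕₚ.+-cancelʳ-≡ (suc n) e (h ℕ.+ t) (begin
  e ℕ.+ suc n               ≡⟨ eq ⟩
  suc (suc m) choose 2      ≡⟨ triangle-suc m ⟩
  suc m ℕ.+ t               ≡⟨ cong (λ k → suc k ℕ.+ t) (ℕₚ.m∸n+n≡m n≤m) ⟨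
  suc (h ℕ.+ n) ℕ.+ t       ≡⟨ cong (ℕ._+ t) (ℕₚ.+-suc h n) ⟨
  h ℕ.+ suc n ℕ.+ t         ≡⟨ ℕₚ.+-assoc h (suc n) t ⟩
  h ℕ.+ (suc n ℕ.+ t)       ≡⟨ cong (h ℕ.+_) (ℕₚ.+-comm (suc n) t) ⟩
  h ℕ.+ (t ℕ.+ suc n)       ≡⟨ ℕₚ.+-assoc h t (suc n) ⟨
  h ℕ.+ t ℕ.+ suc n         ∎)
  where
  open ≡.≡-Reasoning
  h = m ∸ n
  t = suc m choose 2

-- Ordered field arithmetic, finite sums and products.

module FieldProperties {c ℓ₁ ℓ₂} (K : OrderedField c ℓ₁ ℓ₂) where

  open OrderedField K hiding (zero)
  open JEP K
  open IsStrictTotalOrder isStrictTotalOrder public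
    using (compare; irrefl; <-resp-≈) renaming (trans to <-trans)
  open import Relation.Binary.Construct.StrictToNonStrict _≈_ _<_ as NonStrict using ()
  open import Algebra.Properties.Ring ring using (-‿distribʳ-*)
  open import Algebra.Solver.Ring.NaturalCoefficients.Default commutativeSemiring
    using (solve; con; _:+_; _:*_; _:=_)
  open import Relation.Binary.Reasoning.Setoid setoid

  ≤-trans : ∀ {x y z} → x ≤ y → y ≤ z → x ≤ z
  ≤-trans = NonStrict.trans isEquivalence <-resp-≈ <-trans

  ≤-resp : ∀ {x x′ y y′} → x ≈ x′ → y ≈ y′ → x ≤ y → x′ ≤ y′
  ≤-resp x≈x′ y≈y′ x≤y = ≤-trans (inj₂ (sym x≈x′)) (≤-trans x≤y (inj₂ y≈y′))

  ≤-antisym : ∀ {x y} → x ≤ y → y ≤ x → x ≈ y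
  ≤-antisym = NonStrict.antisym isEquivalence <-trans irrefl

  <-resp : ∀ {x x′ y y′} → x ≈ x′ → y ≈ y′ → x < y → x′ < y′
  <-resp x≈x′ y≈y′ x<y = proj₁ <-resp-≈ y≈y′ (proj₂ <-resp-≈ x≈x′ x<y)

  +-monoʳ-≤ : ∀ x {y z} → y ≤ z → x + y ≤ x + z
  +-monoʳ-≤ x (inj₁ y<z) = inj₁ (+-monoʳ-< x y<z)
  +-monoʳ-≤ x (inj₂ y≈z) = inj₂ (+-congˡ y≈z)

  +-mono-≤ : ∀ {x y u v} → x ≤ y → u ≤ v → x + u ≤ y + v
  +-mono-≤ {x} {y} {u} {v} x≤y u≤v =
    ≤-trans (+-monoʳ-≤ x u≤v) (≤-resp (+-comm v x) (+-comm v y) (+-monoʳ-≤ v x≤y))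

  +-monoˡ-≤ : ∀ z {x y} → x ≤ y → x + z ≤ y + z
  +-monoˡ-≤ z x≤y = +-mono-≤ x≤y (inj₂ refl)

  +-nonNegative : ∀ {x y} → 0# ≤ x → 0# ≤ y → 0# ≤ x + y
  +-nonNegative 0≤x 0≤y = ≤-resp (+-identityˡ 0#) refl (+-mono-≤ 0≤x 0≤y)

  +-pos-nonNegative : ∀ {x y} → 0# < x → 0# ≤ y → 0# < x + y
  +-pos-nonNegative {x} {y} 0<x 0≤y = NonStrict.<-≤-trans <-trans (proj₁ <-resp-≈) 0<x
    (≤-resp (+-identityʳ x) refl (+-monoʳ-≤ x 0≤y))

  +-nonNegative-≈0 : ∀ {x y} → 0# ≤ x → 0# ≤ y → x + y ≈ 0# → x ≈ 0# × y ≈ 0#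
  +-nonNegative-≈0 {x} {y} 0≤x 0≤y x+y≈0 =
    x≈0 , trans (sym (+-identityˡ y)) (trans (+-congʳ (sym x≈0)) x+y≈0)
    where
    x≈0 : x ≈ 0#
    x≈0 = ≤-antisym (≤-resp (+-identityʳ x) x+y≈0 (+-monoʳ-≤ x 0≤y)) 0≤x

  *-nonNegative : ∀ {x y} → 0# ≤ x → 0# ≤ y → 0# ≤ x * y
  *-nonNegative (inj₁ 0<x) (inj₁ 0<y) = inj₁ (*-pos 0<x 0<y)
  *-nonNegative {x} {y} (inj₂ 0≈x) _ = inj₂ (trans (sym (zeroˡ y)) (*-congʳ 0≈x))
  *-nonNegative {x} {y} (inj₁ _) (inj₂ 0≈y) = inj₂ (trans (sym (zeroʳ x)) (*-congˡ 0≈y))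

  x<y⇒0<y-x : ∀ {x y} → x < y → 0# < y - x
  x<y⇒0<y-x {x} {y} x<y = <-resp (-‿inverseˡ x) (+-comm (- x) y) (+-monoʳ-< (- x) x<y)

  x≤y⇒0≤y-x : ∀ {x y} → x ≤ y → 0# ≤ y - x
  x≤y⇒0≤y-x {x} {y} x≤y = ≤-resp (-‿inverseˡ x) (+-comm (- x) y) (+-monoʳ-≤ (- x) x≤y)

  x+[y-x]≈y : ∀ x y → x + (y - x) ≈ y
  x+[y-x]≈y x y = begin
    x + (y - x)     ≈⟨ +-congˡ (+-comm y (- x)) ⟩
    x + (- x + y)   ≈⟨ +-assoc x (- x) y ⟨
    x - x + y       ≈⟨ +-congʳ (-‿inverseʳ x) ⟩
    0# + y          ≈⟨ +-identityˡ y ⟩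
    y               ∎

  -- Write `y` as `x + (y - x)`; the increment times `z` is nonnegative.
  *-monoˡ-≤ : ∀ {x y z} → 0# ≤ z → x ≤ y → x * z ≤ y * z
  *-monoˡ-≤ {x} {y} {z} 0≤z x≤y = ≤-resp (+-identityʳ _)
    (trans (sym (distribʳ z x (y - x))) (*-congʳ (x+[y-x]≈y x y)))
    (+-monoʳ-≤ (x * z) (*-nonNegative (x≤y⇒0≤y-x x≤y) 0≤z))

  pos⇒≉0 : ∀ {x} → 0# < x → ¬ x ≈ 0#
  pos⇒≉0 0<x x≈0 = irrefl (sym x≈0) 0<x

  x*y≈0⇒x≈0 : ∀ {x y} → 0# < y → x * y ≈ 0# → x ≈ 0#
  x*y≈0⇒x≈0 {x} {y} 0<y xy≈0 = begin
    x                ≈⟨ *-identityʳ x ⟨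
    x * 1#           ≈⟨ *-congˡ (⁻¹-inverseʳ (pos⇒≉0 0<y)) ⟨
    x * (y * y ⁻¹)   ≈⟨ *-assoc x y (y ⁻¹) ⟨
    x * y * y ⁻¹     ≈⟨ *-congʳ xy≈0 ⟩
    0# * y ⁻¹        ≈⟨ zeroˡ _ ⟩
    0#               ∎

  -- If the inverse were 0, then 1 would be 0. If it were negative, then -1, the product of `x` and
  -- the negated inverse, would be positive, whence 1 < 0.
  ⁻¹-pos : ∀ {x} → 0# < x → 0# < x ⁻¹
  ⁻¹-pos {x} 0<x with compare 0# (x ⁻¹)
  ... | tri< 0<x⁻¹ _ _ = 0<x⁻¹
  ... | tri≈ _ 0≈x⁻¹ _ = ⊥-elim (irrefl
    (trans (sym (zeroʳ x)) (trans (*-congˡ 0≈x⁻¹) (⁻¹-inverseʳ (pos⇒≉0 0<x)))) 0<1)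
  ... | tri> _ _ x⁻¹<0 = ⊥-elim (irrefl refl (<-trans 0<1 1<0))
    where
    0<-1 : 0# < - 1#
    0<-1 = <-resp refl
      (begin
        x * (0# - x ⁻¹)   ≈⟨ *-congˡ (+-identityˡ _) ⟩
        x * - (x ⁻¹)      ≈⟨ -‿distribʳ-* x (x ⁻¹) ⟨
        - (x * x ⁻¹)      ≈⟨ -‿cong (⁻¹-inverseʳ (pos⇒≉0 0<x)) ⟩
        - 1#              ∎)
      (*-pos 0<x (x<y⇒0<y-x x⁻¹<0))

    1<0 : 1# < 0#
    1<0 = <-resp (+-identityʳ 1#) (-‿inverseʳ 1#) (+-monoʳ-< 1# 0<-1)

  ^-pos : ∀ {x} → 0# < x → ∀ n → 0# < x ^ n
  ^-pos 0<x zero    = 0<1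
  ^-pos 0<x (suc n) = *-pos 0<x (^-pos 0<x n)

  if-* : ∀ b x → (if b then x else 0#) ≈ x * (if b then 1# else 0#)
  if-* true  x = sym (*-identityʳ x)
  if-* false x = sym (zeroʳ x)

  module _ {a} {A : Set a} where

    ∑-cong : ∀ (xs : List A) {f g : A → Carrier} → (∀ x → f x ≈ g x) → ∑ xs f ≈ ∑ xs g
    ∑-cong []       f≈g = refl
    ∑-cong (x ∷ xs) f≈g = +-cong (f≈g x) (∑-cong xs f≈g)

    ∏-cong : ∀ (xs : List A) {f g : A → Carrier} → (∀ x → f x ≈ g x) → ∏ xs f ≈ ∏ xs g
    ∏-cong []       f≈g = refl
    ∏-cong (x ∷ xs) f≈g = *-cong (f≈g x) (∏-cong xs f≈g)

    ∑-zero : ∀ (xs : List A) → ∑ xs (λ _ → 0#) ≈ 0#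
    ∑-zero []       = refl
    ∑-zero (x ∷ xs) = trans (+-identityˡ _) (∑-zero xs)

    ∑-++ : ∀ (xs ys : List A) f → ∑ (xs ++ ys) f ≈ ∑ xs f + ∑ ys f
    ∑-++ []       ys f = sym (+-identityˡ _)
    ∑-++ (x ∷ xs) ys f = trans (+-congˡ (∑-++ xs ys f)) (sym (+-assoc _ _ _))

    ∑-+ : ∀ (xs : List A) f g → ∑ xs (λ x → f x + g x) ≈ ∑ xs f + ∑ xs g
    ∑-+ []       f g = sym (+-identityˡ _)
    ∑-+ (x ∷ xs) f g = trans (+-congˡ (∑-+ xs f g))
      (solve 4 (λ a b c d → a :+ b :+ (c :+ d) := a :+ c :+ (b :+ d)) refl _ _ _ _)

    *-distribˡ-∑ : ∀ k (xs : List A) f → k * ∑ xs f ≈ ∑ xs (λ x → k * f x)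
    *-distribˡ-∑ k []       f = zeroʳ k
    *-distribˡ-∑ k (x ∷ xs) f = trans (distribˡ k _ _) (+-congˡ (*-distribˡ-∑ k xs f))

    ∑-nonNegative : ∀ (xs : List A) {f} → (∀ x → 0# ≤ f x) → 0# ≤ ∑ xs f
    ∑-nonNegative []       0≤f = inj₂ refl
    ∑-nonNegative (x ∷ xs) 0≤f = +-nonNegative (0≤f x) (∑-nonNegative xs 0≤f)

    ∑-mono-≤ : ∀ (xs : List A) {f g} → (∀ x → f x ≤ g x) → ∑ xs f ≤ ∑ xs g
    ∑-mono-≤ []       f≤g = inj₂ refl
    ∑-mono-≤ (x ∷ xs) f≤g = +-mono-≤ (f≤g x) (∑-mono-≤ xs f≤g)

    ∑-pos : ∀ {xs : List A} {f x} → x ∈ xs → (∀ y → 0# ≤ f y) → 0# < f x → 0# < ∑ xs f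
    ∑-pos {_ ∷ xs} (here ≡refl) 0≤f 0<fx = +-pos-nonNegative 0<fx (∑-nonNegative xs 0≤f)
    ∑-pos {y ∷ xs} (there x∈xs) 0≤f 0<fx =
      <-resp refl (+-comm _ _) (+-pos-nonNegative (∑-pos x∈xs 0≤f 0<fx) (0≤f y))

    ∑≈0⇒≈0 : ∀ {xs : List A} {f x} → x ∈ xs → (∀ y → 0# ≤ f y) → ∑ xs f ≈ 0# → f x ≈ 0#
    ∑≈0⇒≈0 {xs = y ∷ xs} x∈ 0≤f s≈0
      with +-nonNegative-≈0 (0≤f y) (∑-nonNegative xs 0≤f) s≈0 | x∈
    ... | fy≈0 , _    | here ≡refl = fy≈0
    ... | _    , r≈0  | there x∈xs = ∑≈0⇒≈0 x∈xs 0≤f r≈0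

    -- The differences `g y - f y` are nonnegative and sum to 0, so each of them is 0.
    ∑-≤⇒≈ : ∀ {xs : List A} {f g x} → x ∈ xs → (∀ y → f y ≤ g y) → ∑ xs f ≈ ∑ xs g → f x ≈ g x
    ∑-≤⇒≈ {xs} {f} {g} {x} x∈xs f≤g eq = begin
      f x                 ≈⟨ +-identityʳ _ ⟨
      f x + 0#            ≈⟨ +-congˡ (∑≈0⇒≈0 x∈xs (x≤y⇒0≤y-x ∘ f≤g) gap) ⟨
      f x + (g x - f x)   ≈⟨ x+[y-x]≈y _ _ ⟩
      g x                 ∎
      where
      gap : ∑ xs (λ y → g y - f y) ≈ 0#
      gap = begin
        ∑ xs (λ y → g y - f y)
          ≈⟨ x+[y-x]≈y (- ∑ xs f) _ ⟨
        - ∑ xs f + (∑ xs (λ y → g y - f y) - - ∑ xs f)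
          ≈⟨ +-congˡ (+-congˡ (-‿involutive _)) ⟩
        - ∑ xs f + (∑ xs (λ y → g y - f y) + ∑ xs f)
          ≈⟨ +-congˡ (+-comm _ _) ⟩
        - ∑ xs f + (∑ xs f + ∑ xs (λ y → g y - f y))
          ≈⟨ +-congˡ (∑-+ xs f _) ⟨
        - ∑ xs f + ∑ xs (λ y → f y + (g y - f y))
          ≈⟨ +-congˡ (∑-cong xs (λ y → x+[y-x]≈y (f y) (g y))) ⟩
        - ∑ xs f + ∑ xs g
          ≈⟨ +-congˡ eq ⟨
        - ∑ xs f + ∑ xs f
          ≈⟨ -‿inverseˡ _ ⟩
        0#  ∎
        where open import Algebra.Properties.Ring ring using (-‿involutive)

    ∏-scale : ∀ k (xs : List A) (f : A → Carrier) → ∏ xs (λ x → k * f x) ≈ k ^ length xs * ∏ xs f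
    ∏-scale k []       f = sym (*-identityˡ 1#)
    ∏-scale k (x ∷ xs) f = trans (*-congˡ (∏-scale k xs f))
      (solve 4 (λ k a p b → k :* a :* (p :* b) := k :* p :* (a :* b)) refl k _ _ _)

  module _ {a b} {A : Set a} {B : Set b} where

    ∑-map : ∀ (g : A → B) xs f → ∑ (map g xs) f ≈ ∑ xs (f ∘ g)
    ∑-map g []       f = refl
    ∑-map g (x ∷ xs) f = +-congˡ (∑-map g xs f)

    ∏-map : ∀ (g : A → B) xs f → ∏ (map g xs) f ≈ ∏ xs (f ∘ g)
    ∏-map g []       f = refl
    ∏-map g (x ∷ xs) f = *-congˡ (∏-map g xs f)

    ∑-swap : ∀ (xs : List A) (ys : List B) (f : A → B → Carrier) →
             ∑ xs (λ x → ∑ ys (λ y → f x y)) ≈ ∑ ys (λ y → ∑ xs (λ x → f x y))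
    ∑-swap []       ys f = sym (∑-zero ys)
    ∑-swap (x ∷ xs) ys f = trans (+-congˡ (∑-swap xs ys f)) (sym (∑-+ ys _ _))

  ∑-allFin-suc : ∀ n (f : Fin (suc n) → Carrier) →
                 ∑ (allFin (suc n)) f ≈ f zero + ∑ (allFin n) (f ∘ suc)
  ∑-allFin-suc n f = +-congˡ (trans (reflexive (cong (λ xs → ∑ xs f) (≡.sym (map-tabulate id suc))))
                                    (∑-map suc (allFin n) f))

  ∑-states-zero : ∀ m (f : State (suc m) 0 → Carrier) →
                  ∑ (states (suc m) 0) f ≈ ∑ (states m 0) (f ∘ ∷-outside)
  ∑-states-zero m f = ∑-map _ (states m 0) f

  ∑-states-suc : ∀ m n (f : State (suc m) (suc n) → Carrier) →
    ∑ (states (suc m) (suc n)) f ≈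
    ∑ (states m n) (f ∘ ∷-inside) + ∑ (states m (suc n)) (f ∘ ∷-outside)
  ∑-states-suc m n f = trans (∑-++ (map _ (states m n)) _ f)
    (+-cong (∑-map _ (states m n) f) (∑-map _ (states m (suc n)) f))

  -- q-numbers and q-Stirling numbers at a base r ≠ 1, used for both q and 1/q.

  module QNumbers {r} (1-r≉0 : ¬ 1# - r ≈ 0#) where

    private
      inverse : (1# - r) * (1# - r) ⁻¹ ≈ 1#
      inverse = ⁻¹-inverseʳ 1-r≉0

      negate : ∀ k → - (r ^ suc k) ≈ r * - (r ^ k)
      negate k = -‿distribʳ-* r (r ^ k)

    []-zero : [ 0 ]⟨ r ⟩ ≈ 0#
    []-zero = trans (*-congʳ (-‿inverseʳ 1#)) (zeroˡ _)

    []-suc : ∀ k → [ suc k ]⟨ r ⟩ ≈ 1# + r * [ k ]⟨ r ⟩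
    []-suc k = begin
      (1# - r ^ suc k) * i                              ≈⟨ *-congʳ (+-congˡ (negate k)) ⟩
      -- Replacing 1 by `r + (1# - r)` leaves a multiple of r beside the term that cancels the
      -- denominator.
      (1# + r * - (r ^ k)) * i                          ≈⟨ *-congʳ (+-congʳ (x+[y-x]≈y r 1#)) ⟨
      (r + (1# - r) + r * - (r ^ k)) * i
        ≈⟨ solve 4 (λ r d p i → (r :+ d :+ r :* p) :* i := d :* i :+ r :* ((con 1 :+ p) :* i))
             refl r (1# - r) (- (r ^ k)) i ⟩
      (1# - r) * i + r * ((1# - r ^ k) * i)          ≈⟨ +-congʳ inverse ⟩
      1# + r * ((1# - r ^ k) * i)                       ∎
      where i = (1# - r) ⁻¹

    -- In the sum 1 + r + ... + r^k, `[]-suc` splits off the lowest power and this recursion the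
    -- highest.
    []-suc′ : ∀ k → [ suc k ]⟨ r ⟩ ≈ [ k ]⟨ r ⟩ + r ^ k
    []-suc′ zero    = trans ([]-suc 0) (trans (+-congˡ (trans (*-congˡ []-zero) (zeroʳ r)))
                                              (trans (+-comm 1# 0#) (+-congʳ (sym []-zero))))
    []-suc′ (suc k) = begin
      [ suc (suc k) ]⟨ r ⟩                ≈⟨ []-suc (suc k) ⟩
      1# + r * [ suc k ]⟨ r ⟩             ≈⟨ +-congˡ (*-congˡ ([]-suc′ k)) ⟩
      1# + r * ([ k ]⟨ r ⟩ + r ^ k)       ≈⟨ solve 4 (λ o r a p → o :+ r :* (a :+ p) := o :+ r :* a :+ r :* p) refl 1# r _ _ ⟩
      1# + r * [ k ]⟨ r ⟩ + r ^ suc k     ≈⟨ +-congʳ ([]-suc k) ⟨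
      [ suc k ]⟨ r ⟩ + r ^ suc k          ∎

    ∑-geometric : ∀ n → ∑ (allFin n) (λ ξ → r ^ toℕ ξ) ≈ [ n ]⟨ r ⟩
    ∑-geometric zero    = sym []-zero
    ∑-geometric (suc n) = begin
      ∑ (allFin (suc n)) (λ ξ → r ^ toℕ ξ)         ≈⟨ ∑-allFin-suc n _ ⟩
      1# + ∑ (allFin n) (λ ξ → r * r ^ toℕ ξ)      ≈⟨ +-congˡ (*-distribˡ-∑ r (allFin n) _) ⟨
      1# + r * ∑ (allFin n) (λ ξ → r ^ toℕ ξ)      ≈⟨ +-congˡ (*-congˡ (∑-geometric n)) ⟩
      1# + r * [ n ]⟨ r ⟩                          ≈⟨ []-suc n ⟨
      [ suc n ]⟨ r ⟩                               ∎

    S-zero : ∀ a → S r (suc a) 0 ≈ 0#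
    S-zero a = trans (*-congʳ []-zero) (zeroˡ _)

    S-> : ∀ {a b} → a ℕ.< b → S r a b ≈ 0#
    S-> {zero}  {suc b} _         = refl
    S-> {suc a} {suc b} (s≤s a<b) = begin
      r ^ b * S r a b + [ suc b ]⟨ r ⟩ * S r a (suc b)
        ≈⟨ +-cong (*-congˡ (S-> a<b)) (*-congˡ (S-> (ℕₚ.m<n⇒m<1+n a<b))) ⟩
      r ^ b * 0# + [ suc b ]⟨ r ⟩ * 0#
        ≈⟨ +-cong (zeroʳ _) (zeroʳ _) ⟩
      0# + 0#
        ≈⟨ +-identityˡ 0# ⟩
      0#  ∎

    S-diagonal : ∀ a → S r (suc a) (suc a) ≈ r ^ a * S r a a
    S-diagonal a = trans (+-congˡ (trans (*-congˡ (S-> (ℕₚ.n<1+n a))) (zeroʳ _))) (+-identityʳ _)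

-- Uniqueness of invariant functions of a finite Markov kernel.

module MarkovKernel {c ℓ₁ ℓ₂} (K : OrderedField c ℓ₁ ℓ₂) where

  open OrderedField K hiding (zero)
  open FieldProperties K
  open import Relation.Binary.Reasoning.Setoid setoid

  -- The positive part. The three properties that follow characterise it as the least upper bound of
  -- 0 and `x`, and the argument rests on them alone.
  _⁺ : Carrier → Carrier
  x ⁺ with compare 0# x
  ... | tri< _ _ _ = x
  ... | tri≈ _ _ _ = 0#
  ... | tri> _ _ _ = 0#

  ⁺-nonNegative : ∀ x → 0# ≤ x ⁺
  ⁺-nonNegative x with compare 0# x
  ... | tri< 0<x _ _ = inj₁ 0<x
  ... | tri≈ _ _ _   = inj₂ refl
  ... | tri> _ _ _   = inj₂ refl

  x≤x⁺ : ∀ x → x ≤ x ⁺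
  x≤x⁺ x with compare 0# x
  ... | tri< _ _ _   = inj₂ refl
  ... | tri≈ _ 0≈x _ = inj₂ (sym 0≈x)
  ... | tri> _ _ x<0 = inj₁ x<0

  ⁺-least : ∀ {x y} → 0# ≤ y → x ≤ y → x ⁺ ≤ y
  ⁺-least {x} 0≤y x≤y with compare 0# x
  ... | tri< _ _ _ = x≤y
  ... | tri≈ _ _ _ = 0≤y
  ... | tri> _ _ _ = 0≤y

  module FiniteKernel {a} {A : Set a} (xs : List A) (complete : ∀ x → x ∈ xs)
    (P : A → A → Carrier) (P-nonNegative : ∀ x y → 0# ≤ P x y)
    (P-total : ∀ x → ∑ xs (P x) ≈ 1#) where

    -- Stated for signed functions, so that it applies to the difference of two distributions.
    Invariant : (A → Carrier) → Set (a ⊔ ℓ₁)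
    Invariant d = ∀ y → ∑ xs (λ x → d x * P x y) ≈ d y

    module _ {d} (d-invariant : Invariant d) where

      -- The image of the positive part under the kernel is nonnegative and dominates the image of
      -- `d`, which is `d` itself; so it dominates the positive part. Rows of total 1 preserve mass,
      -- which turns the inequality into equality.
      ⁺-invariant : Invariant (λ x → d x ⁺)
      ⁺-invariant y = sym (∑-≤⇒≈ (complete y) subinvariant (sym mass))
        where
        subinvariant : ∀ y → d y ⁺ ≤ ∑ xs (λ x → d x ⁺ * P x y)
        subinvariant y = ⁺-least
          (∑-nonNegative xs (λ x → *-nonNegative (⁺-nonNegative (d x)) (P-nonNegative x y)))
          (≤-resp (d-invariant y) refl
            (∑-mono-≤ xs (λ x → *-monoˡ-≤ (P-nonNegative x y) (x≤x⁺ (d x)))))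

        mass : ∑ xs (λ y → ∑ xs (λ x → d x ⁺ * P x y)) ≈ ∑ xs (λ y → d y ⁺)
        mass = begin
          ∑ xs (λ y → ∑ xs (λ x → d x ⁺ * P x y))   ≈⟨ ∑-swap xs xs _ ⟩
          ∑ xs (λ x → ∑ xs (λ y → d x ⁺ * P x y))   ≈⟨ ∑-cong xs (λ x → *-distribˡ-∑ (d x ⁺) xs (P x)) ⟨
          ∑ xs (λ x → d x ⁺ * ∑ xs (P x))           ≈⟨ ∑-cong xs (λ x → trans (*-congˡ (P-total x)) (*-identityʳ _)) ⟩
          ∑ xs (λ x → d x ⁺)                        ∎

      -- By invariance the value at `y` is a sum of nonnegative terms. If it is 0, so is the term of
      -- `x`, and its factor `P x y` can be divided out.
      ⁺-predecessor : ∀ {x y} → 0# < P x y → d y ⁺ ≈ 0# → d x ⁺ ≈ 0#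
      ⁺-predecessor {x} {y} 0<P dy⁺≈0 = x*y≈0⇒x≈0 0<P
        (∑≈0⇒≈0 (complete x) (λ z → *-nonNegative (⁺-nonNegative (d z)) (P-nonNegative z y))
          (trans (⁺-invariant y) dy⁺≈0))

    -- `reach` says that every state leads to `g` through transitions of positive probability,
    -- phrased as an induction principle.
    module _ (g : A)
      (reach : ∀ {p} (Q : A → Set p) → Q g → (∀ x y → 0# < P x y → Q y → Q x) → ∀ x → Q x) where

      private
        -- The positive part of `μ - ν` vanishes at `g`, hence everywhere by `reach`. So `μ ≤ ν`
        -- pointwise, and equal totals force equality.
        compare-at-g : ∀ {μ ν} → Invariant μ → Invariant ν → μ g ≤ ν g → ∑ xs μ ≈ ∑ xs ν →
                       ∀ x → μ x ≈ ν x
        compare-at-g {μ} {ν} μ-inv ν-inv μg≤νg eq x = ∑-≤⇒≈ (complete x) μ≤ν eq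
          where
          d : A → Carrier
          d x = μ x - ν x

          d-invariant : Invariant d
          d-invariant y = begin
            ∑ xs (λ x → (μ x - ν x) * P x y)
              ≈⟨ ∑-cong xs (λ x → trans (distribʳ _ _ _) (+-congˡ (-1*-comm (ν x) (P x y)))) ⟩
            ∑ xs (λ x → μ x * P x y + - 1# * (ν x * P x y))
              ≈⟨ ∑-+ xs _ _ ⟩
            ∑ xs (λ x → μ x * P x y) + ∑ xs (λ x → - 1# * (ν x * P x y))
              ≈⟨ +-cong (μ-inv y) (sym (*-distribˡ-∑ (- 1#) xs _)) ⟩
            μ y + - 1# * ∑ xs (λ x → ν x * P x y)
              ≈⟨ +-congˡ (trans (*-congˡ (ν-inv y)) (-1*x≈-x (ν y))) ⟩
            d y  ∎
            where
            open import Algebra.Properties.Ring ring using (-1*x≈-x; -‿distribˡ-*)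
            -1*-comm : ∀ u v → - u * v ≈ - 1# * (u * v)
            -1*-comm u v = trans (sym (-‿distribˡ-* u v)) (sym (-1*x≈-x (u * v)))

          d⁺≈0 : ∀ x → d x ⁺ ≈ 0#
          d⁺≈0 = reach _
            (≤-antisym (⁺-least (inj₂ refl) (≤-resp refl (-‿inverseʳ (ν g)) (+-monoˡ-≤ (- ν g) μg≤νg)))
                       (⁺-nonNegative _))
            (λ x y → ⁺-predecessor d-invariant)

          μ≤ν : ∀ x → μ x ≤ ν x
          μ≤ν x = ≤-resp (x+[y-x]≈y (ν x) (μ x)) (+-identityʳ _)
                    (+-monoʳ-≤ (ν x) (≤-trans (x≤x⁺ (d x)) (inj₂ (d⁺≈0 x))))

      invariant-unique : ∀ {μ ν} → Invariant μ → Invariant ν → ∑ xs μ ≈ ∑ xs ν → ∀ x → μ x ≈ ν x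
      invariant-unique {μ} {ν} μ-inv ν-inv eq x with compare (μ g) (ν g)
      ... | tri< μg<νg _ _ = compare-at-g μ-inv ν-inv (inj₁ μg<νg) eq x
      ... | tri≈ _ μg≈νg _ = compare-at-g μ-inv ν-inv (inj₂ μg≈νg) eq x
      ... | tri> _ _ νg<μg = sym (compare-at-g ν-inv μ-inv (inj₁ νg<μg) (sym eq) x)

module Juggling {c ℓ₁ ℓ₂} (K : OrderedField c ℓ₁ ℓ₂) (q : OrderedField.Carrier K)
  (0<q : OrderedField._<_ K (OrderedField.0# K) q)
  (q<1 : OrderedField._<_ K q (OrderedField.1# K)) where

  open OrderedField K hiding (zero)
  open JEP K
  open FieldProperties K
  open import Algebra.Properties.Semiring.Exp semiring using (^-homo-*)
  open import Algebra.Solver.Ring.NaturalCoefficients.Default commutativeSemiring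
    using (solve; con; _:+_; _:*_; _:=_)
  open import Relation.Binary.Reasoning.Setoid setoid

  1-q≉0 : ¬ 1# - q ≈ 0#
  1-q≉0 = pos⇒≉0 (x<y⇒0<y-x q<1)

  open QNumbers 1-q≉0

  -- The product weight in recursive form.

  infix 10 [_]
  [_] : ℕ → Carrier
  [ k ] = [ k ]⟨ q ⟩

  []-nonNegative : ∀ k → 0# ≤ [ k ]
  []-nonNegative zero    = inj₂ (sym []-zero)
  []-nonNegative (suc k) = ≤-resp refl (sym ([]-suc k))
    (+-nonNegative (inj₁ 0<1) (*-nonNegative (inj₁ 0<q) ([]-nonNegative k)))

  []-pos : ∀ k → 0# < [ suc k ]
  []-pos k = <-resp refl (sym ([]-suc k))
    (+-pos-nonNegative 0<1 (*-nonNegative (inj₁ 0<q) ([]-nonNegative k)))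

  -- The product over `x ∈ B`, read from the lowest site. Prepending a site raises each height by
  -- one, hence the factor `q ^ ∣ B ∣`, and leaves the holes above each particle unchanged. A new
  -- particle at 0 sees every hole of `B`.
  weight : ∀ {m} → Subset m → Carrier
  weight []            = 1#
  weight (inside  ∷ B) = [ suc ∣ ∁ B ∣ ] * (q ^ ∣ B ∣ * weight B)
  weight (outside ∷ B) = q ^ ∣ B ∣ * weight B

  weight-pos : ∀ {m} (B : Subset m) → 0# < weight B
  weight-pos []            = 0<1
  weight-pos (inside  ∷ B) = *-pos ([]-pos ∣ ∁ B ∣) (*-pos (^-pos 0<q ∣ B ∣) (weight-pos B))
  weight-pos (outside ∷ B) = *-pos (^-pos 0<q ∣ B ∣) (weight-pos B)

  ∏-elements : ∀ {m} (B : Subset m) →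
               ∏ (elements B) (λ x → [ 1 ℕ.+ holesFrom B x ] * q ^ toℕ x) ≈ weight B
  ∏-elements [] = refl
  ∏-elements {suc m} (b ∷ B) = case b
    where
    factor : ∀ {m} → Subset m → Fin m → Carrier
    factor B x = [ 1 ℕ.+ holesFrom B x ] * q ^ toℕ x

    shifted : ∀ b → ∏ (map suc (elements B)) (factor (b ∷ B)) ≈ q ^ ∣ B ∣ * weight B
    shifted b = begin
      ∏ (map suc (elements B)) (factor (b ∷ B))        ≈⟨ ∏-map suc (elements B) _ ⟩
      ∏ (elements B) (λ x → factor (b ∷ B) (suc x))    ≈⟨ ∏-cong (elements B) pull ⟩
      ∏ (elements B) (λ x → q * factor B x)            ≈⟨ ∏-scale q (elements B) _ ⟩
      q ^ length (elements B) * ∏ (elements B) (factor B)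
        ≈⟨ *-cong (reflexive (cong (q ^_) (length-elements B))) (∏-elements B) ⟩
      q ^ ∣ B ∣ * weight B                             ∎
      where
      pull : ∀ x → factor (b ∷ B) (suc x) ≈ q * factor B x
      pull x = trans (*-congʳ (reflexive (cong (λ k → [ suc k ]) (holesFrom-suc b B x))))
        (solve 3 (λ a q p → a :* (q :* p) := q :* (a :* p)) refl _ _ _)

    case : ∀ b → ∏ (elements (b ∷ B)) (factor (b ∷ B)) ≈ weight (b ∷ B)
    case inside  = *-cong
      (trans (*-identityʳ _) (reflexive (cong (λ k → [ suc k ]) (holesFrom-zero B))))
      (trans (reflexive (cong (λ xs → ∏ xs (factor (inside ∷ B))) (filter-tabulate-suc B)))
             (shifted inside))
    case outside = trans
      (reflexive (cong (λ xs → ∏ xs (factor (outside ∷ B))) (filter-tabulate-suc B)))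
      (shifted outside)

  π-formula-weight : ∀ {m n} (s : State m n) → π-formula q m n s ≈ Z m n q ⁻¹ * weight (proj₁ s)
  π-formula-weight (B , _) = *-congˡ (∏-elements B)

  weight-inside : ∀ {m n} (s : State m n) →
    weight (inside ∷ proj₁ s) ≈ [ suc (m ∸ n) ] * (q ^ n * weight (proj₁ s))
  weight-inside s = reflexive (≡.cong₂ (λ h k → [ suc h ] * (q ^ k * weight (proj₁ s)))
                                       (∣∁∣-State s) (proj₂ s))

  weight-outside : ∀ {m n} (s : State m n) →
    weight (outside ∷ proj₁ s) ≈ q ^ n * weight (proj₁ s)
  weight-outside s = reflexive (cong (λ k → q ^ k * weight (proj₁ s)) (proj₂ s))

  -- The partition function and the q-Stirling numbers at 1/q.

  partition : ℕ → ℕ → Carrier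
  partition m n = ∑ (states m n) (weight ∘ proj₁)

  partition-zero : ∀ m → partition (suc m) 0 ≈ partition m 0
  partition-zero m = trans (∑-states-zero m _)
    (∑-cong (states m 0) (λ s → trans (weight-outside s) (*-identityˡ _)))

  partition-suc : ∀ m n → partition (suc m) (suc n) ≈
    [ suc (m ∸ n) ] * (q ^ n * partition m n) + q ^ suc n * partition m (suc n)
  partition-suc m n = trans (∑-states-suc m n _) (+-cong
    (trans (∑-cong (states m n) weight-inside)
           (trans (sym (*-distribˡ-∑ _ (states m n) _)) (*-congˡ (sym (*-distribˡ-∑ _ (states m n) _)))))
    (trans (∑-cong (states m (suc n)) weight-outside) (sym (*-distribˡ-∑ _ (states m (suc n)) _))))

  partition-pos : ∀ {m n} → n ℕ.≤ m → 0# < partition m n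
  partition-pos n≤m = ∑-pos (∈-states (ground n≤m)) (λ s → inj₁ (weight-pos (proj₁ s)))
                            (weight-pos (proj₁ (ground n≤m)))

  partition-> : ∀ {m n} → m ℕ.< n → partition m n ≈ 0#
  partition-> {zero}  {suc n} _         = refl
  partition-> {suc m} {suc n} (s≤s m<n) = begin
    partition (suc m) (suc n)
      ≈⟨ partition-suc m n ⟩
    [ suc (m ∸ n) ] * (q ^ n * partition m n) + q ^ suc n * partition m (suc n)
      ≈⟨ +-cong (*-congˡ (*-congˡ (partition-> m<n))) (*-congˡ (partition-> (ℕₚ.m<n⇒m<1+n m<n))) ⟩
    [ suc (m ∸ n) ] * (q ^ n * 0#) + q ^ suc n * 0#
      ≈⟨ solve 3 (λ a b d → a :* (b :* con 0) :+ d :* con 0 := con 0) refl _ _ _ ⟩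
    0#  ∎

  r : Carrier
  r = q ⁻¹

  q*r≈1 : q * r ≈ 1#
  q*r≈1 = ⁻¹-inverseʳ (pos⇒≉0 0<q)

  1-r≉0 : ¬ 1# - r ≈ 0#
  1-r≉0 1-r≈0 = irrefl q≈1 q<1
    where
    r≈1 : r ≈ 1#
    r≈1 = trans (sym (+-identityʳ r)) (trans (+-congˡ (sym 1-r≈0)) (x+[y-x]≈y r 1#))
    q≈1 : q ≈ 1#
    q≈1 = trans (sym (*-identityʳ q)) (trans (*-congˡ (sym r≈1)) q*r≈1)

  module R = QNumbers 1-r≉0

  ^-cancel : ∀ n → q ^ n * r ^ n ≈ 1#
  ^-cancel zero    = *-identityˡ 1#
  ^-cancel (suc n) = begin
    q * q ^ n * (r * r ^ n)     ≈⟨ solve 4 (λ a b x y → a :* b :* (x :* y) := a :* x :* (b :* y)) refl _ _ _ _ ⟩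
    q * r * (q ^ n * r ^ n)     ≈⟨ *-cong q*r≈1 (^-cancel n) ⟩
    1# * 1#                     ≈⟨ *-identityˡ 1# ⟩
    1#                          ∎

  -- Multiplication by q^k reverses the sum 1 + r + ... + r^k. The induction therefore splits off
  -- the highest power of r against the lowest power of q.
  []-invert : ∀ k → q ^ k * [ suc k ]⟨ r ⟩ ≈ [ suc k ]
  []-invert zero    = begin
    1# * [ 1 ]⟨ r ⟩            ≈⟨ *-identityˡ _ ⟩
    [ 1 ]⟨ r ⟩                 ≈⟨ R.[]-suc 0 ⟩
    1# + r * [ 0 ]⟨ r ⟩        ≈⟨ +-congˡ (trans (*-congˡ R.[]-zero) (zeroʳ r)) ⟩
    1# + 0#                    ≈⟨ +-congˡ (trans (*-congˡ []-zero) (zeroʳ q)) ⟨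
    1# + q * [ 0 ]             ≈⟨ []-suc 0 ⟨
    [ 1 ]                      ∎
  []-invert (suc k) = begin
    q ^ suc k * [ suc (suc k) ]⟨ r ⟩                         ≈⟨ *-congˡ (R.[]-suc′ (suc k)) ⟩
    q ^ suc k * ([ suc k ]⟨ r ⟩ + r ^ suc k)                 ≈⟨ distribˡ _ _ _ ⟩
    q ^ suc k * [ suc k ]⟨ r ⟩ + q ^ suc k * r ^ suc k       ≈⟨ +-cong (*-assoc _ _ _) (^-cancel (suc k)) ⟩
    q * (q ^ k * [ suc k ]⟨ r ⟩) + 1#                        ≈⟨ +-congʳ (*-congˡ ([]-invert k)) ⟩
    q * [ suc k ] + 1#                                       ≈⟨ +-comm _ _ ⟩
    1# + q * [ suc k ]                                       ≈⟨ []-suc (suc k) ⟨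
    [ suc (suc k) ]                                          ∎

  -- The site at height 0 splits the sum as the Stirling recursion does. With h = m - n in the
  -- inductive case, a particle there gives the term with `[ suc h ]⟨ r ⟩`, a hole the term with
  -- `r ^ h`. The exponent `e` is fixed by an addition, which avoids truncated subtraction.
  partition-Stirling : ∀ m n e → n ℕ.≤ m → e ℕ.+ n ≡ suc m choose 2 →
                       partition m n ≈ q ^ e * S r (suc m) (suc (m ∸ n))
  partition-Stirling zero zero zero _ _ = begin
    1# + 0#                                         ≈⟨ +-congʳ (*-identityˡ 1#) ⟨
    1# * 1# + 0#                                    ≈⟨ +-congˡ (zeroʳ _) ⟨
    1# * 1# + [ 1 ]⟨ r ⟩ * 0#                       ≈⟨ *-identityˡ _ ⟨
    1# * (1# * 1# + [ 1 ]⟨ r ⟩ * 0#)                ∎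
  partition-Stirling (suc m) zero e _ eq = begin
    partition (suc m) 0                             ≈⟨ partition-zero m ⟩
    partition m 0                                   ≈⟨ partition-Stirling m 0 t z≤n (ℕₚ.+-identityʳ _) ⟩
    q ^ t * S r (suc m) (suc m)                     ≈⟨ *-identityˡ _ ⟨
    -- Of the inserted product 1 = q^(m+1) r^(m+1), the power of q completes the exponent and the
    -- power of r is the factor in `S-diagonal`.
    1# * (q ^ t * S r (suc m) (suc m))              ≈⟨ *-congʳ (^-cancel (suc m)) ⟨
    q ^ suc m * r ^ suc m * (q ^ t * S r (suc m) (suc m))
      ≈⟨ solve 4 (λ a b c d → a :* b :* (c :* d) := a :* c :* (b :* d)) refl _ _ _ _ ⟩
    q ^ suc m * q ^ t * (r ^ suc m * S r (suc m) (suc m))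
      ≈⟨ *-cong (^-homo-* q (suc m) t) (R.S-diagonal (suc m)) ⟨
    q ^ (suc m ℕ.+ t) * S r (suc (suc m)) (suc (suc m))
      ≈⟨ *-congʳ (reflexive (cong (q ^_) e≡)) ⟨
    q ^ e * S r (suc (suc m)) (suc (suc m))         ∎
    where
    t = suc m choose 2
    e≡ : e ≡ suc m ℕ.+ t
    e≡ = ≡.trans (≡.sym (ℕₚ.+-identityʳ e)) (≡.trans eq (triangle-suc m))
  partition-Stirling (suc m) (suc n) e (s≤s n≤m) eq = begin
    partition (suc m) (suc n)
      ≈⟨ partition-suc m n ⟩
    [ suc h ] * (q ^ n * partition m n) + q ^ suc n * partition m (suc n)
      ≈⟨ +-cong (*-cong ([]-invert h) (*-congˡ (sym (partition-Stirling m n e′ n≤m e′+n≡t)))) (sym last) ⟨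
    q ^ h * [ suc h ]⟨ r ⟩ * (q ^ n * (q ^ e′ * S r (suc m) (suc h))) + q ^ t * S r (suc m) h
      -- Inserting 1 = q^h r^h supplies the coefficient `r ^ h` of the recursion and gives both
      -- terms the common factor `q ^ h`.
      ≈⟨ +-congˡ (trans (*-congʳ (^-cancel h)) (*-identityˡ _)) ⟨
    q ^ h * [ suc h ]⟨ r ⟩ * (q ^ n * (q ^ e′ * S r (suc m) (suc h)))
      + q ^ h * r ^ h * (q ^ t * S r (suc m) h)
      ≈⟨ +-congˡ (*-congˡ (*-congʳ (power e′ n e′+n≡t))) ⟩
    q ^ h * [ suc h ]⟨ r ⟩ * (q ^ n * (q ^ e′ * S r (suc m) (suc h)))
      + q ^ h * r ^ h * (q ^ e′ * q ^ n * S r (suc m) h)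
      ≈⟨ solve 7 (λ a b c d s p u → a :* b :* (c :* (d :* s)) :+ a :* p :* (d :* c :* u)
                                 := a :* (d :* c) :* (p :* u :+ b :* s))
               refl (q ^ h) ([ suc h ]⟨ r ⟩) (q ^ n) (q ^ e′) (S r (suc m) (suc h)) (r ^ h) (S r (suc m) h) ⟩
    q ^ h * (q ^ e′ * q ^ n) * S r (suc (suc m)) (suc h)
      ≈⟨ *-congʳ (*-congˡ (power e′ n e′+n≡t)) ⟨
    q ^ h * q ^ t * S r (suc (suc m)) (suc h)
      ≈⟨ *-congʳ (^-homo-* q h t) ⟨
    q ^ (h ℕ.+ t) * S r (suc (suc m)) (suc h)
      ≈⟨ *-congʳ (reflexive (cong (q ^_) e≡)) ⟨
    q ^ e * S r (suc (suc m)) (suc h)  ∎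
    where
    h = m ∸ n
    t = suc m choose 2
    e′ = t ∸ n

    n≤t : n ℕ.≤ t
    n≤t = ℕₚ.≤-trans n≤m (m≤triangle m)

    e′+n≡t : e′ ℕ.+ n ≡ t
    e′+n≡t = ℕₚ.m∸n+n≡m n≤t

    power : ∀ a b {c} → a ℕ.+ b ≡ c → q ^ c ≈ q ^ a * q ^ b
    power a b ≡refl = ^-homo-* q a b

    e≡ : e ≡ h ℕ.+ t
    e≡ = triangle-split n≤m eq

    -- For `n = m` both sides vanish: no state has more particles than sites, and the second
    -- Stirling index is 0.
    last : q ^ suc n * partition m (suc n) ≈ q ^ t * S r (suc m) h
    last with ℕₚ.m≤n⇒m<n∨m≡n n≤m
    ... | inj₂ ≡refl = begin
      q ^ suc n * partition n (suc n)      ≈⟨ *-congˡ (partition-> (ℕₚ.n<1+n n)) ⟩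
      q ^ suc n * 0#                       ≈⟨ zeroʳ _ ⟩
      0#                                   ≈⟨ zeroʳ _ ⟨
      q ^ t * 0#                           ≈⟨ *-congˡ (R.S-zero n) ⟨
      q ^ t * S r (suc n) 0                ≈⟨ *-congˡ (reflexive (cong (S r (suc n)) (ℕₚ.n∸n≡0 n))) ⟨
      q ^ t * S r (suc n) (n ∸ n)          ∎
    ... | inj₁ n<m = begin
      q ^ suc n * partition m (suc n)
        ≈⟨ *-congˡ (partition-Stirling m (suc n) (t ∸ suc n) n<m e″+n≡t) ⟩
      q ^ suc n * (q ^ (t ∸ suc n) * S r (suc m) (suc (m ∸ suc n)))
        ≈⟨ solve 3 (λ a b s → a :* (b :* s) := b :* a :* s) refl _ _ _ ⟩
      q ^ (t ∸ suc n) * q ^ suc n * S r (suc m) (suc (m ∸ suc n))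
        ≈⟨ *-cong (power (t ∸ suc n) (suc n) e″+n≡t) (reflexive (cong (S r (suc m)) (ℕₚ.+-∸-assoc 1 n<m))) ⟨
      q ^ t * S r (suc m) h  ∎
      where
      e″+n≡t : t ∸ suc n ℕ.+ suc n ≡ t
      e″+n≡t = ℕₚ.m∸n+n≡m (ℕₚ.≤-trans n<m (m≤triangle m))

  partition-Z : ∀ {m n} → n ℕ.≤ m → partition m n ≈ Z m n q
  partition-Z {m} {n} n≤m = partition-Stirling m n _ n≤m (ℕₚ.m∸n+n≡m (ℕₚ.≤-trans n≤m (m≤triangle m)))

  -- The equilibrium equation for the weight.

  δ : ∀ {m} → Subset m → Subset m → Carrier
  δ X Y = if does (≡-dec _≟ᵇ_ X Y) then 1# else 0#

  δ-refl : ∀ {m} (X : Subset m) → δ X X ≡ 1#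
  δ-refl []            = ≡refl
  δ-refl (inside  ∷ X) = δ-refl X
  δ-refl (outside ∷ X) = δ-refl X

  δ-nonNegative : ∀ {m} (X Y : Subset m) → 0# ≤ δ X Y
  δ-nonNegative X Y with does (≡-dec _≟ᵇ_ X Y)
  ... | true  = inj₁ 0<1
  ... | false = inj₂ refl

  ∑-*0 : ∀ {a} {A : Set a} (xs : List A) (f : A → Carrier) → ∑ xs (λ x → f x * 0#) ≈ 0#
  ∑-*0 xs f = trans (∑-cong xs (λ x → zeroʳ (f x))) (∑-zero xs)

  -- Expresses that `states` lists every state exactly once.
  ∑-δ : ∀ {m n} (s : State m n) → ∑ (states m n) (λ t → δ (proj₁ s) (proj₁ t)) ≈ 1#
  ∑-δ ([] , ≡refl) = +-identityʳ 1#
  ∑-δ {suc m} {suc n} (inside ∷ X , ≡refl) = begin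
    ∑ (states (suc m) (suc n)) (λ t → δ (inside ∷ X) (proj₁ t))   ≈⟨ ∑-states-suc m n _ ⟩
    ∑ (states m n) (λ t → δ X (proj₁ t)) + ∑ (states m (suc n)) (λ _ → 0#)
      ≈⟨ +-cong (∑-δ (X , ≡refl)) (∑-zero (states m (suc n))) ⟩
    1# + 0#                                                       ≈⟨ +-identityʳ 1# ⟩
    1#                                                            ∎
  ∑-δ {suc m} {zero} (outside ∷ X , p) = trans (∑-states-zero m _) (∑-δ (X , p))
  ∑-δ {suc m} {suc n} (outside ∷ X , p) = begin
    ∑ (states (suc m) (suc n)) (λ t → δ (outside ∷ X) (proj₁ t))  ≈⟨ ∑-states-suc m n _ ⟩
    ∑ (states m n) (λ _ → 0#) + ∑ (states m (suc n)) (λ t → δ X (proj₁ t))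
      ≈⟨ +-cong (∑-zero (states m n)) (∑-δ (X , p)) ⟩
    0# + 1#                                                       ≈⟨ +-identityˡ 1# ⟩
    1#                                                            ∎

  -- In the equilibrium equation at Y, idle n Y collects the predecessors of Y
  -- without a particle at 0.  Those with a particle at 0 contribute inflow n Y:
  -- their weight has the factor [ℓ] that cancels the normalisation of ξ.
  idle : ∀ {m} → ℕ → Subset (suc m) → Carrier
  idle {m} n Y = ∑ (states m n) λ s → weight (proj₁ s) * δ (proj₁ s ∷ʳ outside) Y

  -- The transition probability from `inside ∷ X` to `Y` without its normalisation; `suc ∣ ∁ X ∣` is
  -- the number ℓ of possible throws.
  landing : ∀ {m} → Subset m → Subset (suc m) → Carrier
  landing X Y = ∑ (allFin (suc ∣ ∁ X ∣)) λ ξ → q ^ toℕ ξ * δ (step (inside ∷ X) (toℕ ξ)) Y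

  throw : ∀ {m} → ℕ → Subset (suc m) → Carrier
  throw {m} k Y = ∑ (states m k) λ s → weight (proj₁ s) * landing (proj₁ s) Y

  inflow : ∀ {m} → ℕ → Subset (suc m) → Carrier
  inflow zero    Y = 0#
  inflow (suc k) Y = q ^ k * throw k Y

  -- A particle at height 1 comes down to 0 under every throw.
  landing-inside-outside : ∀ {m} (X : Subset m) Y → landing (inside ∷ X) (outside ∷ Y) ≈ 0#
  landing-inside-outside X Y = ∑-*0 (allFin (suc ∣ ∁ X ∣)) _

  -- After the shift 0 is the lowest hole, and only the throw ξ = 0 fills it.
  landing-outside-inside : ∀ {m} (X : Subset m) Y →
    landing (outside ∷ X) (inside ∷ Y) ≈ δ (X ∷ʳ outside) Y
  landing-outside-inside X Y = begin
    landing (outside ∷ X) (inside ∷ Y)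
      ≈⟨ ∑-allFin-suc (suc ∣ ∁ X ∣) _ ⟩
    1# * δ (step (inside ∷ outside ∷ X) 0) (inside ∷ Y)
      + ∑ (allFin (suc ∣ ∁ X ∣)) (λ ξ → q ^ suc (toℕ ξ) * 0#)
      ≈⟨ +-cong (*-identityˡ _) (∑-*0 (allFin (suc ∣ ∁ X ∣)) _) ⟩
    δ (step (inside ∷ outside ∷ X) 0) (inside ∷ Y) + 0#
      ≈⟨ +-identityʳ _ ⟩
    δ (step (inside ∷ outside ∷ X) 0) (inside ∷ Y)
      ≈⟨ reflexive (cong (λ A → δ A (inside ∷ Y)) (step-outside-zero X)) ⟩
    δ (X ∷ʳ outside) Y  ∎

  -- The throw must pass over the hole at 0. So ξ = 0 is excluded, and ξ + 1 acts on the remaining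
  -- sites as ξ does, at the cost of one factor q.
  landing-outside-outside : ∀ {m} (X : Subset m) Y →
    landing (outside ∷ X) (outside ∷ Y) ≈ q * landing X Y
  landing-outside-outside X Y = begin
    landing (outside ∷ X) (outside ∷ Y)
      ≈⟨ ∑-allFin-suc (suc ∣ ∁ X ∣) _ ⟩
    1# * 0# + ∑ (allFin (suc ∣ ∁ X ∣)) (λ ξ → q * q ^ toℕ ξ * δ (step (inside ∷ X) (toℕ ξ)) Y)
      ≈⟨ +-cong (zeroʳ 1#) (∑-cong (allFin (suc ∣ ∁ X ∣)) (λ ξ → *-assoc q _ _)) ⟩
    0# + ∑ (allFin (suc ∣ ∁ X ∣)) (λ ξ → q * (q ^ toℕ ξ * δ (step (inside ∷ X) (toℕ ξ)) Y))
      ≈⟨ +-identityˡ _ ⟩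
    ∑ (allFin (suc ∣ ∁ X ∣)) (λ ξ → q * (q ^ toℕ ξ * δ (step (inside ∷ X) (toℕ ξ)) Y))
      ≈⟨ *-distribˡ-∑ q (allFin (suc ∣ ∁ X ∣)) _ ⟨
    q * landing X Y  ∎

  idle-outside : ∀ {m} n (Y : Subset (suc m)) → idle n (outside ∷ Y) ≈ q ^ n * idle n Y
  idle-outside {m} n Y = trans (split n) (trans (∑-cong (states m n) pull) (sym (*-distribˡ-∑ _ (states m n) _)))
    where
    pull : (s : State m n) → weight (outside ∷ proj₁ s) * δ (proj₁ s ∷ʳ outside) Y
                           ≈ q ^ n * (weight (proj₁ s) * δ (proj₁ s ∷ʳ outside) Y)
    pull s = trans (*-congʳ (weight-outside s)) (*-assoc _ _ _)

    split : ∀ n → idle n (outside ∷ Y) ≈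
            ∑ (states m n) (λ s → weight (outside ∷ proj₁ s) * δ (proj₁ s ∷ʳ outside) Y)
    split zero    = ∑-states-zero m _
    split (suc n) = trans (∑-states-suc m n _)
      (trans (+-congʳ (∑-*0 (states m n) _)) (+-identityˡ _))

  throw-outside : ∀ {m} k (Y : Subset (suc m)) → throw k (outside ∷ Y) ≈ q ^ suc k * throw k Y
  throw-outside {m} k Y = trans (split k) (trans (∑-cong (states m k) pull) (sym (*-distribˡ-∑ _ (states m k) _)))
    where
    pull : (s : State m k) → weight (outside ∷ proj₁ s) * landing (outside ∷ proj₁ s) (outside ∷ Y)
                           ≈ q ^ suc k * (weight (proj₁ s) * landing (proj₁ s) Y)
    pull s = trans (*-cong (weight-outside s) (landing-outside-outside (proj₁ s) Y))
      (solve 4 (λ p w q l → p :* w :* (q :* l) := q :* p :* (w :* l)) refl _ _ _ _)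

    split : ∀ k → throw k (outside ∷ Y) ≈
            ∑ (states m k) (λ s → weight (outside ∷ proj₁ s) * landing (outside ∷ proj₁ s) (outside ∷ Y))
    split zero    = ∑-states-zero m _
    split (suc k) = trans (∑-states-suc m k _) (trans (+-congʳ
      (trans (∑-cong (states m k) (λ s → *-congˡ (landing-inside-outside (proj₁ s) Y)))
             (∑-*0 (states m k) _)))
      (+-identityˡ _))

  inflow-outside : ∀ {m} n (Y : Subset (suc m)) → inflow n (outside ∷ Y) ≈ q ^ n * inflow n Y
  inflow-outside zero    Y = sym (zeroʳ _)
  inflow-outside (suc k) Y = trans (*-congˡ (throw-outside k Y))
    (solve 3 (λ p r t → p :* (r :* t) := r :* (p :* t)) refl _ _ _)

  -- Site 0 is occupied after a throw for one of two reasons: ξ = 0 filled it, which gives the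
  -- `idle` term, or a particle came down from height 1, which gives the `inflow` term.
  throw-inside : ∀ {m} k (Y : Subset (suc m)) → ∣ Y ∣ ≡ k →
                 throw k (inside ∷ Y) ≈ q ^ k * idle k Y + [ suc ∣ ∁ Y ∣ ] * inflow k Y
  throw-inside {m} k Y p = trans (split k p) (+-cong
      (trans (∑-cong (states m k) pull) (sym (*-distribˡ-∑ _ (states m k) _))) refl)
    where
    pull : (s : State m k) → weight (outside ∷ proj₁ s) * landing (outside ∷ proj₁ s) (inside ∷ Y)
                           ≈ q ^ k * (weight (proj₁ s) * δ (proj₁ s ∷ʳ outside) Y)
    pull s = trans (*-cong (weight-outside s) (landing-outside-inside (proj₁ s) Y)) (*-assoc _ _ _)

    idle′ : ℕ → Carrier
    idle′ k = ∑ (states m k) (λ s → weight (outside ∷ proj₁ s) * landing (outside ∷ proj₁ s) (inside ∷ Y))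

    split : ∀ k → ∣ Y ∣ ≡ k → throw k (inside ∷ Y) ≈ idle′ k + [ suc ∣ ∁ Y ∣ ] * inflow k Y
    split zero    p = trans (∑-states-zero m _) (sym (trans (+-congˡ (zeroʳ _)) (+-identityʳ _)))
    split (suc j) p = trans (∑-states-suc m j _) (trans (+-comm _ _) (+-congˡ (begin
      ∑ (states m j) (λ s → weight (inside ∷ proj₁ s) * landing (inside ∷ proj₁ s) (inside ∷ Y))
        -- `landing (inside ∷ X) (inside ∷ Y)` unfolds to `landing X Y`, because `θ` skips an
        -- occupied site.
        ≈⟨ ∑-cong (states m j) (λ s → trans (*-congʳ (weight-inside s))
             (solve 4 (λ h p w l → h :* (p :* w) :* l := h :* (p :* (w :* l))) refl _ _ _ _)) ⟩
      ∑ (states m j) (λ s → [ suc (m ∸ j) ] * (q ^ j * (weight (proj₁ s) * landing (proj₁ s) Y)))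
        ≈⟨ *-distribˡ-∑ _ (states m j) _ ⟨
      [ suc (m ∸ j) ] * ∑ (states m j) (λ s → q ^ j * (weight (proj₁ s) * landing (proj₁ s) Y))
        ≈⟨ *-congˡ (*-distribˡ-∑ _ (states m j) _) ⟨
      [ suc (m ∸ j) ] * inflow (suc j) Y
        ≈⟨ *-congʳ (reflexive (cong (λ h → [ suc h ]) (∣∁∣-State (Y , p)))) ⟨
      [ suc ∣ ∁ Y ∣ ] * inflow (suc j) Y  ∎)))

  -- The appended hole raises the number of holes above each particle by one,
  -- which is compensated by [k+1] = 1 + q [k].
  idle-inside : ∀ {m} k (Y : Subset (suc m)) → ∣ Y ∣ ≡ k →
    q * idle (suc k) (inside ∷ Y) + q ^ k * idle k Y ≈ [ suc ∣ ∁ Y ∣ ] * (q ^ k * idle k Y)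
  idle-inside {m} k Y p = begin
    q * idle (suc k) (inside ∷ Y) + q ^ k * idle k Y
      ≈⟨ +-congʳ (*-congˡ split) ⟩
    q * ([ suc (m ∸ k) ] * (q ^ k * idle k Y)) + q ^ k * idle k Y
      ≈⟨ solve 4 (λ q h r i → q :* (h :* (r :* i)) :+ r :* i := r :* ((con 1 :+ q :* h) :* i)) refl _ _ _ _ ⟩
    q ^ k * ((1# + q * [ suc (m ∸ k) ]) * idle k Y)
      ≈⟨ *-congˡ (*-distribˡ-∑ _ (states m k) _) ⟩
    q ^ k * ∑ (states m k) (λ s → (1# + q * [ suc (m ∸ k) ]) * (weight (proj₁ s) * δ (proj₁ s ∷ʳ outside) Y))
      ≈⟨ *-congˡ (∑-cong (states m k) (λ s → *-congʳ (holes s))) ⟩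
    q ^ k * ∑ (states m k) (λ s → [ suc ∣ ∁ Y ∣ ] * (weight (proj₁ s) * δ (proj₁ s ∷ʳ outside) Y))
      ≈⟨ *-congˡ (*-distribˡ-∑ _ (states m k) _) ⟨
    q ^ k * ([ suc ∣ ∁ Y ∣ ] * idle k Y)
      ≈⟨ solve 3 (λ r h i → r :* (h :* i) := h :* (r :* i)) refl _ _ _ ⟩
    [ suc ∣ ∁ Y ∣ ] * (q ^ k * idle k Y)  ∎
    where
    -- The state supplies `k ≤ m`. For a full `Y` one has k = m + 1 and the equation fails, but then
    -- the sum over states is empty; hence its use inside the sum.
    holes : State m k → 1# + q * [ suc (m ∸ k) ] ≈ [ suc ∣ ∁ Y ∣ ]
    holes s = trans (sym ([]-suc (suc (m ∸ k)))) (reflexive (cong (λ h → [ suc h ])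
      (≡.sym (≡.trans (∣∁∣-State (Y , p)) (ℕₚ.+-∸-assoc 1 (n≤m-State s))))))

    split : idle (suc k) (inside ∷ Y) ≈ [ suc (m ∸ k) ] * (q ^ k * idle k Y)
    split = begin
      idle (suc k) (inside ∷ Y)
        ≈⟨ trans (∑-states-suc m k _) (trans (+-congˡ (∑-*0 (states m (suc k)) _)) (+-identityʳ _)) ⟩
      ∑ (states m k) (λ s → weight (inside ∷ proj₁ s) * δ (proj₁ s ∷ʳ outside) Y)
        ≈⟨ ∑-cong (states m k) (λ s → trans (*-congʳ (weight-inside s))
             (solve 4 (λ h p w d → h :* (p :* w) :* d := h :* p :* (w :* d)) refl _ _ _ _)) ⟩
      ∑ (states m k) (λ s → [ suc (m ∸ k) ] * q ^ k * (weight (proj₁ s) * δ (proj₁ s ∷ʳ outside) Y))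
        ≈⟨ *-distribˡ-∑ _ (states m k) _ ⟨
      [ suc (m ∸ k) ] * q ^ k * idle k Y
        ≈⟨ *-assoc _ _ _ ⟩
      [ suc (m ∸ k) ] * (q ^ k * idle k Y)  ∎

  -- Induction on `Y`. A hole at 0 multiplies every term by `q ^ n`. For a particle at 0,
  -- `throw-inside` splits the inflow; its idle part joins the idle term through `idle-inside`, so
  -- that both parts carry the factor `[ suc ∣ ∁ Y ∣ ]` of the new particle.
  weight-balance : ∀ {m} n (Y : Subset (suc m)) → ∣ Y ∣ ≡ n →
                   weight Y ≈ q ^ n * idle n Y + inflow n Y
  weight-balance {zero} _ (inside ∷ []) ≡refl = begin
    [ 1 ] * (1# * 1#)                              ≈⟨ *-congʳ (trans ([]-suc 0) (+-congˡ (trans (*-congˡ []-zero) (zeroʳ q)))) ⟩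
    (1# + 0#) * (1# * 1#)
      ≈⟨ solve 1 (λ q → (con 1 :+ con 0) :* (con 1 :* con 1) := q :* con 1 :* con 0 :+ con 1 :* (con 1 :* (con 1 :* con 1 :+ con 0) :+ con 0)) refl q ⟩
    q * 1# * 0# + 1# * (1# * (1# * 1# + 0#) + 0#)  ∎
  weight-balance {zero} _ (outside ∷ []) ≡refl =
    solve 0 (con 1 :* con 1 := con 1 :* (con 1 :* con 1 :+ con 0) :+ con 0) refl
  weight-balance {suc m} _ (outside ∷ Y) ≡refl = begin
    q ^ n * weight Y                                ≈⟨ *-congˡ (weight-balance n Y ≡refl) ⟩
    q ^ n * (q ^ n * idle n Y + inflow n Y)         ≈⟨ distribˡ _ _ _ ⟩
    q ^ n * (q ^ n * idle n Y) + q ^ n * inflow n Y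
      ≈⟨ +-cong (*-congˡ (idle-outside n Y)) (inflow-outside n Y) ⟨
    q ^ n * idle n (outside ∷ Y) + inflow n (outside ∷ Y)  ∎
    where n = ∣ Y ∣
  weight-balance {suc m} _ (inside ∷ Y) ≡refl = begin
    h * (q ^ k * weight Y)
      ≈⟨ *-congˡ (*-congˡ (weight-balance k Y ≡refl)) ⟩
    h * (q ^ k * (q ^ k * idle k Y + inflow k Y))
      ≈⟨ solve 4 (λ h p i j → h :* (p :* (p :* i :+ j)) := p :* (h :* (p :* i)) :+ p :* (h :* j)) refl _ _ _ _ ⟩
    q ^ k * (h * (q ^ k * idle k Y)) + q ^ k * (h * inflow k Y)
      ≈⟨ +-congʳ (*-congˡ (idle-inside k Y ≡refl)) ⟨
    q ^ k * (q * idle (suc k) (inside ∷ Y) + q ^ k * idle k Y) + q ^ k * (h * inflow k Y)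
      ≈⟨ solve 5 (λ p q e i j → p :* (q :* e :+ i) :+ p :* j := q :* p :* e :+ p :* (i :+ j)) refl
           (q ^ k) q (idle (suc k) (inside ∷ Y)) (q ^ k * idle k Y) (h * inflow k Y) ⟩
    q ^ suc k * idle (suc k) (inside ∷ Y) + q ^ k * (q ^ k * idle k Y + h * inflow k Y)
      ≈⟨ +-congˡ (*-congˡ (throw-inside k Y ≡refl)) ⟨
    q ^ suc k * idle (suc k) (inside ∷ Y) + inflow (suc k) (inside ∷ Y)  ∎
    where
    k = ∣ Y ∣
    h = [ suc ∣ ∁ Y ∣ ]

  -- The truncated geometric law and the transition probabilities.

  geometric-norm : ∀ n → (1# - q) / (1# - q ^ suc n) * [ suc n ] ≈ 1#
  geometric-norm n = begin
    (1# - q) * (1# - q ^ suc n) ⁻¹ * ((1# - q ^ suc n) * (1# - q) ⁻¹)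
      ≈⟨ solve 4 (λ a b c d → a :* b :* (c :* d) := a :* d :* (c :* b)) refl _ _ _ _ ⟩
    (1# - q) * (1# - q) ⁻¹ * ((1# - q ^ suc n) * (1# - q ^ suc n) ⁻¹)
      ≈⟨ *-cong (⁻¹-inverseʳ 1-q≉0) (⁻¹-inverseʳ 1-q^≉0) ⟩
    1# * 1#
      ≈⟨ *-identityˡ 1# ⟩
    1#  ∎
    where
    1-q^≉0 : ¬ 1# - q ^ suc n ≈ 0#
    1-q^≉0 eq = pos⇒≉0 ([]-pos n) (trans (*-congʳ eq) (zeroˡ _))

  truncGeom-total : ∀ n → ∑ (allFin (suc n)) (truncGeom q (suc n)) ≈ 1#
  truncGeom-total n = trans (sym (*-distribˡ-∑ _ (allFin (suc n)) _))
    (trans (*-congˡ (∑-geometric (suc n))) (geometric-norm n))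

  truncGeom-pos : ∀ n ξ → 0# < truncGeom q (suc n) ξ
  truncGeom-pos n ξ = *-pos (*-pos 0<1-q (⁻¹-pos 0<1-q^)) (^-pos 0<q (toℕ ξ))
    where
    0<1-q : 0# < 1# - q
    0<1-q = x<y⇒0<y-x q<1
    0<1-q^ : 0# < 1# - q ^ suc n
    -- Obtained as the product of the positive numbers `[ suc n ]` and `1# - q`.
    0<1-q^ = <-resp refl
      (trans (*-assoc _ _ _) (trans (*-congˡ (trans (*-comm _ _) (⁻¹-inverseʳ 1-q≉0))) (*-identityʳ _)))
      (*-pos ([]-pos n) 0<1-q)

  transition-δ : ∀ {m n} (s t : State m n) → transition q m n s t ≈
    ∑ (allFin (suc (m ∸ n))) (λ ξ → truncGeom q (suc (m ∸ n)) ξ * δ (step (proj₁ s) (toℕ ξ)) (proj₁ t))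
  transition-δ {m} {n} s t = ∑-cong (allFin (suc (m ∸ n))) (λ ξ → trans
    (if-* (does (≡-dec _≟ᵇ_ (proj₁ (update s ξ)) (proj₁ t))) _)
    (*-congˡ (reflexive (cong (λ X → δ X (proj₁ t)) (update-step s ξ)))))

  transition-nonNegative : ∀ {m n} (s t : State m n) → 0# ≤ transition q m n s t
  transition-nonNegative {m} {n} s t = ≤-resp refl (sym (transition-δ s t))
    (∑-nonNegative (allFin (suc (m ∸ n))) (λ ξ →
      *-nonNegative (inj₁ (truncGeom-pos (m ∸ n) ξ)) (δ-nonNegative (step (proj₁ s) (toℕ ξ)) (proj₁ t))))

  transition-total : ∀ {m n} (s : State m n) → ∑ (states m n) (transition q m n s) ≈ 1#
  transition-total {m} {n} s = begin
    ∑ (states m n) (transition q m n s)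
      ≈⟨ ∑-cong (states m n) (transition-δ s) ⟩
    ∑ (states m n) (λ t → ∑ ξs (λ ξ → g ξ * δ (step (proj₁ s) (toℕ ξ)) (proj₁ t)))
      ≈⟨ ∑-swap (states m n) ξs _ ⟩
    ∑ ξs (λ ξ → ∑ (states m n) (λ t → g ξ * δ (step (proj₁ s) (toℕ ξ)) (proj₁ t)))
      ≈⟨ ∑-cong ξs collapse ⟩
    ∑ ξs g
      ≈⟨ truncGeom-total (m ∸ n) ⟩
    1#  ∎
    where
    ξs = allFin (suc (m ∸ n))
    g = truncGeom q (suc (m ∸ n))

    collapse : ∀ ξ → ∑ (states m n) (λ t → g ξ * δ (step (proj₁ s) (toℕ ξ)) (proj₁ t)) ≈ g ξ
    collapse ξ = begin
      ∑ (states m n) (λ t → g ξ * δ (step (proj₁ s) (toℕ ξ)) (proj₁ t))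
        ≈⟨ *-distribˡ-∑ (g ξ) (states m n) _ ⟨
      g ξ * ∑ (states m n) (λ t → δ (step (proj₁ s) (toℕ ξ)) (proj₁ t))
        ≈⟨ *-congˡ (∑-cong (states m n) (λ t → reflexive (cong (λ X → δ X (proj₁ t)) (update-step s ξ)))) ⟨
      g ξ * ∑ (states m n) (λ t → δ (proj₁ (update s ξ)) (proj₁ t))
        ≈⟨ *-congˡ (∑-δ (update s ξ)) ⟩
      g ξ * 1#
        ≈⟨ *-identityʳ _ ⟩
      g ξ  ∎

  transition-update : ∀ {m n} (s : State m n) → 0# < transition q m n s (update s zero)
  transition-update {m} {n} s = <-resp refl (sym (transition-δ s (update s zero)))
    (∑-pos (∈-allFin zero)
      (λ ξ → *-nonNegative (inj₁ (truncGeom-pos (m ∸ n) ξ)) (δ-nonNegative (step (proj₁ s) (toℕ ξ)) (proj₁ (update s zero))))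
      (<-resp refl (sym (trans (*-congˡ (reflexive here-δ)) (*-identityʳ _))) (truncGeom-pos (m ∸ n) zero)))
    where
    here-δ : δ (step (proj₁ s) 0) (proj₁ (update s zero)) ≡ 1#
    here-δ = ≡.trans (cong (δ (step (proj₁ s) 0)) (update-step s zero)) (δ-refl (step (proj₁ s) 0))

  -- With site 0 empty the move does not depend on ξ, so the probabilities of the throws add up to
  -- 1.
  transition-outside : ∀ {m n} (s : State m n) (t : State (suc m) n) →
                       transition q (suc m) n (∷-outside s) t ≈ δ (proj₁ s ∷ʳ outside) (proj₁ t)
  transition-outside {m} {n} s t = begin
    transition q (suc m) n (∷-outside s) t
      ≈⟨ transition-δ (∷-outside s) t ⟩
    ∑ ξs (λ ξ → g ξ * d)      ≈⟨ ∑-cong ξs (λ ξ → *-comm (g ξ) d) ⟩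
    ∑ ξs (λ ξ → d * g ξ)      ≈⟨ *-distribˡ-∑ d ξs g ⟨
    d * ∑ ξs g                ≈⟨ *-congˡ (truncGeom-total (suc m ∸ n)) ⟩
    d * 1#                    ≈⟨ *-identityʳ d ⟩
    d                         ∎
    where
    ξs = allFin (suc (suc m ∸ n))
    g = truncGeom q (suc (suc m ∸ n))
    d = δ (proj₁ s ∷ʳ outside) (proj₁ t)

  transition-inside : ∀ {m n} (s : State m n) (t : State (suc m) (suc n)) →
    weight (inside ∷ proj₁ s) * transition q (suc m) (suc n) (∷-inside s) t ≈
    q ^ n * (weight (proj₁ s) * landing (proj₁ s) (proj₁ t))
  transition-inside {m} {n} s t = begin
    weight (inside ∷ X) * transition q (suc m) (suc n) (∷-inside s) t
      ≈⟨ *-cong (weight-inside s) (trans (transition-δ (∷-inside s) t)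
           (trans (∑-cong (allFin (suc (m ∸ n))) (λ ξ → *-assoc _ _ _))
                  (sym (*-distribˡ-∑ _ (allFin (suc (m ∸ n))) _)))) ⟩
    [ suc (m ∸ n) ] * (q ^ n * weight X) * (c′ * land (m ∸ n))
      ≈⟨ solve 5 (λ h p w c l → h :* (p :* w) :* (c :* l) := c :* h :* (p :* (w :* l))) refl _ _ _ _ _ ⟩
    c′ * [ suc (m ∸ n) ] * (q ^ n * (weight X * land (m ∸ n)))
      ≈⟨ trans (*-congʳ (geometric-norm (m ∸ n))) (*-identityˡ _) ⟩
    q ^ n * (weight X * land (m ∸ n))
      ≈⟨ *-congˡ (*-congˡ (reflexive (cong land (∣∁∣-State s)))) ⟨
    q ^ n * (weight X * landing X (proj₁ t))  ∎
    where
    X = proj₁ s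
    c′ = (1# - q) / (1# - q ^ suc (m ∸ n))
    -- The number of throws is a parameter, so that `m ∸ n` can be exchanged for `∣ ∁ X ∣`.
    land : ℕ → Carrier
    land h = ∑ (allFin (suc h)) (λ ξ → q ^ toℕ ξ * δ (step (inside ∷ X) (toℕ ξ)) (proj₁ t))

  -- Stationarity of the product formula and uniqueness.

  weight-invariant : ∀ {m n} → 1 ℕ.≤ n → n ℕ.≤ m → (t : State m n) →
    ∑ (states m n) (λ s → weight (proj₁ s) * transition q m n s t) ≈ weight (proj₁ t)
  weight-invariant {suc m} {suc n} _ _ t = begin
    ∑ (states (suc m) (suc n)) (λ s → weight (proj₁ s) * transition q (suc m) (suc n) s t)
      ≈⟨ ∑-states-suc m n _ ⟩
    ∑ (states m n) (λ s → weight (inside ∷ proj₁ s) * transition q (suc m) (suc n) (∷-inside s) t)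
      + ∑ (states m (suc n)) (λ s → weight (outside ∷ proj₁ s) * transition q (suc m) (suc n) (∷-outside s) t)
      ≈⟨ +-cong (∑-cong (states m n) (λ s → transition-inside s t))
                (∑-cong (states m (suc n)) (λ s →
                  trans (*-cong (weight-outside s) (transition-outside s t)) (*-assoc _ _ _))) ⟩
    ∑ (states m n) (λ s → q ^ n * (weight (proj₁ s) * landing (proj₁ s) (proj₁ t)))
      + ∑ (states m (suc n)) (λ s → q ^ suc n * (weight (proj₁ s) * δ (proj₁ s ∷ʳ outside) (proj₁ t)))
      ≈⟨ +-cong (*-distribˡ-∑ _ (states m n) _) (*-distribˡ-∑ _ (states m (suc n)) _) ⟨
    inflow (suc n) (proj₁ t) + q ^ suc n * idle (suc n) (proj₁ t)
      ≈⟨ +-comm _ _ ⟩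
    q ^ suc n * idle (suc n) (proj₁ t) + inflow (suc n) (proj₁ t)
      ≈⟨ weight-balance (suc n) (proj₁ t) (proj₂ t) ⟨
    weight (proj₁ t)  ∎

  -- `Z` equals the sum of the positive weights, and `n ≤ m` ensures that there is a state.
  Z-pos : ∀ {m n} → n ℕ.≤ m → 0# < Z m n q
  Z-pos n≤m = <-resp refl (partition-Z n≤m) (partition-pos n≤m)

  π-formula-stationary : ∀ {m n} → 1 ℕ.≤ n → n ℕ.≤ m → IsStationary q m n (π-formula q m n)
  π-formula-stationary {m} {n} 1≤n n≤m = record
    { nonNegative = λ s → ≤-resp refl (sym (π-formula-weight s))
        (inj₁ (*-pos (⁻¹-pos (Z-pos n≤m)) (weight-pos (proj₁ s))))
    ; total = begin
        ∑ (states m n) (π-formula q m n)                        ≈⟨ ∑-cong (states m n) π-formula-weight ⟩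
        ∑ (states m n) (λ s → Z m n q ⁻¹ * weight (proj₁ s))    ≈⟨ *-distribˡ-∑ _ (states m n) _ ⟨
        Z m n q ⁻¹ * partition m n                              ≈⟨ *-comm _ _ ⟩
        partition m n * Z m n q ⁻¹                              ≈⟨ *-congʳ (partition-Z n≤m) ⟩
        Z m n q * Z m n q ⁻¹                                    ≈⟨ ⁻¹-inverseʳ (pos⇒≉0 (Z-pos n≤m)) ⟩
        1#                                                      ∎
    ; invariant = λ t → begin
        ∑ (states m n) (λ s → π-formula q m n s * transition q m n s t)
          ≈⟨ ∑-cong (states m n) (λ s → trans (*-congʳ (π-formula-weight s)) (*-assoc _ _ _)) ⟩
        ∑ (states m n) (λ s → Z m n q ⁻¹ * (weight (proj₁ s) * transition q m n s t))
          ≈⟨ *-distribˡ-∑ _ (states m n) _ ⟨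
        Z m n q ⁻¹ * ∑ (states m n) (λ s → weight (proj₁ s) * transition q m n s t)
          ≈⟨ *-congˡ (weight-invariant 1≤n n≤m t) ⟩
        Z m n q ⁻¹ * weight (proj₁ t)
          ≈⟨ π-formula-weight t ⟨
        π-formula q m n t  ∎
    }

  stationary-unique : ∀ {m n} → n ℕ.≤ m → ∀ {μ ν} → IsStationary q m n μ → IsStationary q m n ν →
                      ∀ s → μ s ≈ ν s
  stationary-unique {m} {n} n≤m μ-st ν-st = invariant-unique (ground n≤m)
    -- The throw ξ = 0 has positive probability, so the induction towards the ground state runs
    -- along admissible transitions.
    (λ Q base back → ground-induction n≤m Q base (λ s → back s (update s zero) (transition-update s)))
    (invariant μ-st) (invariant ν-st) (trans (total μ-st) (sym (total ν-st)))
    where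
    open IsStationary
    open MarkovKernel K
    open FiniteKernel (states m n) ∈-states (transition q m n) transition-nonNegative transition-total

theorem2p1 :
    ∀ {c ℓ₁ ℓ₂} (K : OrderedField c ℓ₁ ℓ₂) →
    let open OrderedField K
        open JEP K in
    (q : Carrier) → 0# < q → q < 1# →
    (m n : ℕ) → 1 ℕ.≤ n → n ℕ.≤ m →
    IsStationary q m n (π-formula q m n) ×
    (∀ (π : State m n → Carrier) → IsStationary q m n π →
     ∀ (B : State m n) → π B ≈ π-formula q m n B)
theorem2p1 K q 0<q q<1 m n 1≤n n≤m =
  stationary , λ π π-stationary → stationary-unique n≤m π-stationary stationary
  where
  open Juggling K q 0<q q<1
  stationary = π-formula-stationary 1≤n n≤m
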